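{- Let $p>3$ be a prime and $k\in\{2,4,\ldots,p-3\}$. Then $$\sum_{x=1}^{[p/6]}\frac1{x^k}\equiv6^k\sum_{\substack{x=1\\6\mid x-p}}^{p-1}\frac1{x^k}\equiv\frac{6^k(2^k+1)}{4(2^{k-1}+1)}\left(\frac p3\right)U_{p-1-k}\pmod p$$ and $$\sum_{x=1}^{[p/3]}\frac1{x^k}\equiv3^k\sum_{\substack{x=1\\3\mid x-p}}^{p-1}\frac1{x^k}\equiv\frac{6^k}{4(2^{k-1}+1)}\left(\frac p3\right)U_{p-1-k}\pmod p.$$
   Context: $[x]$ is the greatest integer not exceeding $x$; empty sums are $0$. The sequence $\{U_n\}_{n\ge0}$ is defined by $U_0=1$ and $U_n=-2\sum_{j=1}^{[n/2]}\binom n{2j}U_{n-2j}$ for $n\ge1$. $\left(\frac p3\right)$ is the Legendre symbol: it equals $1$ if $p\equiv1\pmod3$ and $-1$ if $p\equiv2\pmod3$. Congruences modulo $p$ are between rational numbers whose denominators are coprime to $p$.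
   Formalization: The second congruence of each chain (the one involving U_{p-1-k}) is stated only when p does not divide 4(2^{k-1}+1); without this it is false, e.g. p=11, k=6, where the [p/6] sum is 1 but the right side is ≡ 10 (mod 11). -}

module Defs where

open import Data.Bool.Base using (if_then_else_)
open import Data.Integer.Base as ℤ using (ℤ; +_; 0ℤ; 1ℤ; -1ℤ)
import Data.Integer.Divisibility.Signed as ℤ
open import Data.List.Base using (foldr; applyUpTo)
open import Data.Nat.Base using (ℕ; zero; suc; _+_; _*_; _∸_; _^_; NonZero; ⌊_/2⌋)
open import Data.Nat.Combinatorics using (_C_)
open import Data.Nat.Coprimality using (Coprime)
open import Data.Nat.DivMod using (_%_)
open import Data.Nat.Properties using (m^n≢0; +-suc; +-identityʳ; *-suc)
open import Data.Product.Base using (_×_)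
open import Data.Rational.Base as ℚ using (ℚ; 0ℚ; ↥_; ↧ₙ_)
open import Relation.Binary.PropositionalEquality
  using (_≡_; refl; sym; trans; cong; cong₂)
open import Relation.Nullary.Decidable.Core using (does)

-- ∑ℤ n f = f 1 + ⋯ + f n, and likewise for ∑ℚ.
∑ℤ : ℕ → (ℕ → ℤ) → ℤ
∑ℤ n f = foldr ℤ._+_ 0ℤ (applyUpTo (λ i → f (suc i)) n)

∑ℚ : ℕ → ((x : ℕ) → .{{NonZero x}} → ℚ) → ℚ
∑ℚ n f = foldr ℚ._+_ 0ℚ (applyUpTo (λ i → f (suc i)) n)

1/_^_ : (x k : ℕ) → .{{NonZero x}} → ℚ
1/ x ^ k = ℚ._/_ 1ℤ (x ^ k) {{m^n≢0 x k}}

-- The sum of 1/x^k over 1 ≤ x ≤ n.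
powerSum : (n k : ℕ) → ℚ
powerSum n k = ∑ℚ n (λ x → 1/ x ^ k)

-- The sum of 1/x^k over 1 ≤ x ≤ n with m ∣ x - a (as integers).
powerSumAP : (m a n k : ℕ) → ℚ
powerSumAP m a n k =
  ∑ℚ n (λ x → if does (+ m ℤ.∣? (+ x ℤ.- + a)) then 1/ x ^ k else 0ℚ)

-- U-sum n m j = ∑_{i ≥ 0, 2(i+1) ≤ m} C(n, 2(j+i)) U(m - 2(i+1)); the separate
-- argument m only makes the recursion structural.  U-rec below is the
-- defining recurrence in its usual form.
mutual
  U : ℕ → ℤ
  U zero          = 1ℤ
  U n@(suc _)     = (ℤ.- + 2) ℤ.* U-sum n n 1

  U-sum : ℕ → ℕ → ℕ → ℤ
  U-sum n (suc (suc m)) j = + (n C (2 * j)) ℤ.* U m ℤ.+ U-sum n m (suc j)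
  U-sum n _             j = 0ℤ

private
  foldr-cong : ∀ m {f g : ℕ → ℤ} → (∀ i → f i ≡ g i) →
               foldr ℤ._+_ 0ℤ (applyUpTo f m) ≡ foldr ℤ._+_ 0ℤ (applyUpTo g m)
  foldr-cong zero    eq = refl
  foldr-cong (suc m) eq = cong₂ ℤ._+_ (eq 0) (foldr-cong m (λ i → eq (suc i)))

  U-sum-∑ : ∀ n m j → U-sum n m j ≡
    foldr ℤ._+_ 0ℤ (applyUpTo (λ i → + (n C (2 * (j + i))) ℤ.* U (m ∸ 2 * suc i)) ⌊ m /2⌋)
  U-sum-∑ n zero          j = refl
  U-sum-∑ n (suc zero)    j = refl
  U-sum-∑ n (suc (suc m)) j = cong₂ ℤ._+_
    (cong (λ t → + (n C (2 * t)) ℤ.* U m) (sym (+-identityʳ j)))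
    (trans (U-sum-∑ n m (suc j))
           (foldr-cong ⌊ m /2⌋ λ i →
             cong₂ (λ t s → + (n C (2 * t)) ℤ.* U (suc (suc m) ∸ s))
                   (sym (+-suc j i)) (sym (*-suc 2 (suc i)))))

U-rec : ∀ n → .{{NonZero n}} →
        U n ≡ (ℤ.- + 2) ℤ.* ∑ℤ ⌊ n /2⌋ (λ j → + (n C (2 * j)) ℤ.* U (n ∸ 2 * j))
U-rec n@(suc _) = cong ((ℤ.- + 2) ℤ.*_) (U-sum-∑ n n 1)

-- The Legendre symbol (p/3).
legendre₃ : ℕ → ℤ
legendre₃ p with p % 3
... | 0 = 0ℤ
... | 1 = 1ℤ
... | _ = -1ℤ

fromℤ : ℤ → ℚ
fromℤ z = z ℚ./ 1

infix 4 _≡_[mod_]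

-- ℚ is kept in lowest terms, so ↧ₙ is the reduced denominator.
_≡_[mod_] : ℚ → ℚ → ℕ → Set
a ≡ b [mod p ] = Coprime (↧ₙ a) p × Coprime (↧ₙ b) p × (+ p ℤ.∣ ↥ (a ℚ.- b))

{-# OPTIONS --safe #-}

-- Put n = p - 1 - k.  By Fermat 1/x^k reduces to x^n modulo p, and x ↦ p - x turns the sums
-- over x ≡ p (mod d) into sums over multiples of d.  So only T(N) = 1^n + ... + N^n modulo p at
-- N = [p/6] and N = [p/3] matters.
--
-- The generating function of U is 1/(e^t + e^{-t} - 1), hence V(x) = ∑ C(n,i) x^i U_{n-i}
-- satisfies V(x+1) - V(x) + V(x-1) = x^n.  The solutions of the homogeneous recurrence have
-- period 6, so w(x) = V(x+1) - V(x) satisfies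
--   w(x+6) - w(x) = (x+5)^n - (x+3)^n - (x+2)^n + x^n,
-- and telescoping this in steps of 6 up to about p, where V returns to its values near 0 modulo p,
-- expresses ± U_n by the power sums over the residue classes modulo 6.  These are multiples of
-- T([p/6]) and of the sum over the odd x ≤ p/3; the latter is removed by reflecting
-- x ↦ p - x and using T((p-1)/2) ≡ 0.

module Submission where

open import Defs
open import Data.Bool.Base using (true; false; if_then_else_)
open import Data.Integer.Base using (ℤ; +_; 0ℤ; 1ℤ; -1ℤ; ∣_∣)
open import Data.Integer.Divisibility.Signed as ℤ using (divides)
import Data.Integer.Properties as ℤ
open import Data.Integer.Tactic.RingSolver using (solve-∀)
open import Data.List.Base using (_∷_; foldr; applyUpTo)
open import Data.Nat.Base as ℕ using (ℕ; zero; suc)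
open import Data.Nat.Combinatorics using (_C_; nCk+nC[k+1]≡[n+1]C[k+1]; k>n⇒nCk≡0; nCn≡1)
open import Data.Nat.Coprimality using (Coprime)
import Data.Nat.DivMod as ℕ
import Data.Nat.Divisibility as ℕ
import Data.Nat.GCD as ℕ
open import Data.Nat.Primality
  using (Prime; euclidsLemma; prime⇒nonZero; prime⇒nonTrivial; prime⇒irreducible)
import Data.Nat.Properties as ℕ
open import Data.Nat.Tactic.RingSolver using () renaming (solve-∀ to ℕ-solve-∀)
open import Data.Product.Base using (_×_; _,_; ∃; proj₁; proj₂)
open import Data.Rational.Base as ℚ using (ℚ; 0ℚ; ↥_; ↧_; ↧ₙ_)
import Data.Rational.Properties as ℚ
open import Data.Sum.Base using (_⊎_; inj₁; inj₂; [_,_]′)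
open import Function.Base using (_∘_)
open import Function.Bundles using (mk⇔)
open import Relation.Binary.Bundles using (Setoid)
open import Relation.Binary.PropositionalEquality
  using (_≡_; refl; sym; trans; cong; cong₂; subst; module ≡-Reasoning)
import Relation.Binary.Reasoning.Setoid as SetoidReasoning
open import Relation.Nullary.Decidable using (does; does-⇔; dec-true; dec-false)
open import Relation.Nullary.Negation using (¬_; contradiction)

module _ where

  open import Data.Integer.Base using (_+_; _*_; _-_; -_; _^_)

  -- Exponential generating functions and their products.

  exp : ℤ → ℕ → ℤ
  exp x i = x ^ i

  ^-distribʳ-* : ∀ x y n → (x * y) ^ n ≡ x ^ n * y ^ n
  ^-distribʳ-* x y zero    = refl
  ^-distribʳ-* x y (suc n) = trans (cong (x * y *_) (^-distribʳ-* x y n)) (lemma x y (x ^ n) (y ^ n))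
    where
    lemma : ∀ x y s t → x * y * (s * t) ≡ x * s * (y * t)
    lemma = solve-∀

  infixl 7 _⋆_

  -- The product of exponential generating functions, defined by the Leibniz rule
  -- (shifting a sequence differentiates its generating function).
  _⋆_ : (ℕ → ℤ) → (ℕ → ℤ) → ℕ → ℤ
  (a ⋆ b) zero    = a 0 * b 0
  (a ⋆ b) (suc n) = (a ∘ suc ⋆ b) n + (a ⋆ b ∘ suc) n

  +-interchange : ∀ w x y z → (w + x) + (y + z) ≡ (w + y) + (x + z)
  +-interchange = solve-∀

  ⋆-distribʳ-+ : ∀ n a b c → ((λ i → a i + b i) ⋆ c) n ≡ (a ⋆ c) n + (b ⋆ c) n
  ⋆-distribʳ-+ zero    a b c = ℤ.*-distribʳ-+ (c 0) (a 0) (b 0)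
  ⋆-distribʳ-+ (suc n) a b c = trans
    (cong₂ _+_ (⋆-distribʳ-+ n (a ∘ suc) (b ∘ suc) c) (⋆-distribʳ-+ n a b (c ∘ suc)))
    (+-interchange ((a ∘ suc ⋆ c) n) _ _ _)

  ⋆-distribˡ-+ : ∀ n a b c → (a ⋆ (λ i → b i + c i)) n ≡ (a ⋆ b) n + (a ⋆ c) n
  ⋆-distribˡ-+ zero    a b c = ℤ.*-distribˡ-+ (a 0) (b 0) (c 0)
  ⋆-distribˡ-+ (suc n) a b c = trans
    (cong₂ _+_ (⋆-distribˡ-+ n (a ∘ suc) b c) (⋆-distribˡ-+ n a (b ∘ suc) (c ∘ suc)))
    (+-interchange ((a ∘ suc ⋆ b) n) _ _ _)

  ⋆-scaleˡ : ∀ n x a b → ((λ i → x * a i) ⋆ b) n ≡ x * (a ⋆ b) n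
  ⋆-scaleˡ zero    x a b = ℤ.*-assoc x (a 0) (b 0)
  ⋆-scaleˡ (suc n) x a b = trans
    (cong₂ _+_ (⋆-scaleˡ n x (a ∘ suc) b) (⋆-scaleˡ n x a (b ∘ suc)))
    (sym (ℤ.*-distribˡ-+ x _ _))

  ⋆-scaleʳ : ∀ n x a b → (a ⋆ (λ i → x * b i)) n ≡ x * (a ⋆ b) n
  ⋆-scaleʳ zero    x a b = lemma (a 0) x (b 0)
    where
    lemma : ∀ s x t → s * (x * t) ≡ x * (s * t)
    lemma = solve-∀
  ⋆-scaleʳ (suc n) x a b = trans
    (cong₂ _+_ (⋆-scaleʳ n x (a ∘ suc) b) (⋆-scaleʳ n x a (b ∘ suc)))
    (sym (ℤ.*-distribˡ-+ x _ _))

  ⋆-comm : ∀ n a b → (a ⋆ b) n ≡ (b ⋆ a) n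
  ⋆-comm zero    a b = ℤ.*-comm (a 0) (b 0)
  ⋆-comm (suc n) a b = trans (ℤ.+-comm _ ((a ⋆ b ∘ suc) n))
    (cong₂ _+_ (⋆-comm n a (b ∘ suc)) (⋆-comm n (a ∘ suc) b))

  -- Differentiate both sides: by the Leibniz rule each becomes the sum of the same three triple
  -- products, with one factor shifted in each.
  ⋆-assoc : ∀ n a b c → ((a ⋆ b) ⋆ c) n ≡ (a ⋆ (b ⋆ c)) n
  ⋆-assoc zero    a b c = ℤ.*-assoc (a 0) (b 0) (c 0)
  ⋆-assoc (suc n) a b c = begin
    ((λ i → (a ∘ suc ⋆ b) i + (a ⋆ b ∘ suc) i) ⋆ c) n + ((a ⋆ b) ⋆ c ∘ suc) n
      ≡⟨ cong (_+ ((a ⋆ b) ⋆ c ∘ suc) n) (⋆-distribʳ-+ n _ _ c) ⟩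
    ((a ∘ suc ⋆ b) ⋆ c) n + ((a ⋆ b ∘ suc) ⋆ c) n + ((a ⋆ b) ⋆ c ∘ suc) n
      ≡⟨ cong₂ _+_ (cong₂ _+_ (⋆-assoc n (a ∘ suc) b c) (⋆-assoc n a (b ∘ suc) c))
                   (⋆-assoc n a b (c ∘ suc)) ⟩
    (a ∘ suc ⋆ (b ⋆ c)) n + (a ⋆ (b ∘ suc ⋆ c)) n + (a ⋆ (b ⋆ c ∘ suc)) n
      ≡⟨ ℤ.+-assoc ((a ∘ suc ⋆ (b ⋆ c)) n) _ _ ⟩
    (a ∘ suc ⋆ (b ⋆ c)) n + ((a ⋆ (b ∘ suc ⋆ c)) n + (a ⋆ (b ⋆ c ∘ suc)) n)
      ≡⟨ cong (_+_ ((a ∘ suc ⋆ (b ⋆ c)) n)) (⋆-distribˡ-+ n a _ _) ⟨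
    (a ∘ suc ⋆ (b ⋆ c)) n + (a ⋆ (b ⋆ c) ∘ suc) n ∎
    where open ≡-Reasoning

  -- This is the binomial theorem, e^{xt} e^{yt} = e^{(x+y)t}. Shifting `exp x` multiplies it by
  -- `x`, so the Leibniz rule makes the product grow by the factor `x + y`.
  ⋆-exp : ∀ n x y → (exp x ⋆ exp y) n ≡ (x + y) ^ n
  ⋆-exp zero    x y = refl
  ⋆-exp (suc n) x y = begin
    (exp x ∘ suc ⋆ exp y) n + (exp x ⋆ exp y ∘ suc) n
      ≡⟨ cong₂ _+_ (⋆-scaleˡ n x (exp x) (exp y)) (⋆-scaleʳ n y (exp x) (exp y)) ⟩
    x * (exp x ⋆ exp y) n + y * (exp x ⋆ exp y) n
      ≡⟨ ℤ.*-distribʳ-+ ((exp x ⋆ exp y) n) x y ⟨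
    (x + y) * (exp x ⋆ exp y) n
      ≡⟨ cong ((x + y) *_) (⋆-exp n x y) ⟩
    (x + y) ^ suc n ∎
    where open ≡-Reasoning

  -- As 0^0 = 1, `exp 0ℤ` is the sequence 1, 0, 0, ..., that is, the constant series 1.
  ⋆-identityʳ : ∀ n a → (a ⋆ exp 0ℤ) n ≡ a n
  ⋆-identityʳ zero    a = ℤ.*-identityʳ (a 0)
  ⋆-identityʳ (suc n) a = begin
    (a ∘ suc ⋆ exp 0ℤ) n + (a ⋆ (λ i → 0ℤ * exp 0ℤ i)) n
      ≡⟨ cong₂ _+_ (⋆-identityʳ n (a ∘ suc)) (⋆-scaleʳ n 0ℤ a (exp 0ℤ)) ⟩
    a (suc n) + 0ℤ * (a ⋆ exp 0ℤ) n
      ≡⟨ cong (_+_ (a (suc n))) (ℤ.*-zeroˡ ((a ⋆ exp 0ℤ) n)) ⟩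
    a (suc n) + 0ℤ
      ≡⟨ ℤ.+-identityʳ (a (suc n)) ⟩
    a (suc n) ∎
    where open ≡-Reasoning

  ⋆-identityˡ : ∀ n a → (exp 0ℤ ⋆ a) n ≡ a n
  ⋆-identityˡ n a = trans (⋆-comm n (exp 0ℤ) a) (⋆-identityʳ n a)

  -- binomialSum a b n m j = ∑_{i ≤ m} C(n, j+i) a_{j+i} b_{m-i}
  binomialSum : (ℕ → ℤ) → (ℕ → ℤ) → ℕ → ℕ → ℕ → ℤ
  binomialSum a b n zero    j = + (n C j) * (a j * b 0)
  binomialSum a b n (suc m) j = + (n C j) * (a j * b (suc m)) + binomialSum a b n m (suc j)

  -- Peeling off the term with `b 0` leaves a sum with `b` shifted, the form in which the second
  -- summand of the Leibniz rule occurs.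
  binomialSum-last : ∀ a b n m j → binomialSum a b n (suc m) j ≡
    binomialSum a (b ∘ suc) n m j + + (n C (suc m ℕ.+ j)) * (a (suc m ℕ.+ j) * b 0)
  binomialSum-last a b n zero    j = refl
  binomialSum-last a b n (suc m) j = begin
    s + binomialSum a b n (suc m) (suc j)
      ≡⟨ cong (_+_ s) (binomialSum-last a b n m (suc j)) ⟩
    s + (binomialSum a (b ∘ suc) n m (suc j) + t (suc m ℕ.+ suc j))
      ≡⟨ cong (λ l → s + (binomialSum a (b ∘ suc) n m (suc j) + t l)) (ℕ.+-suc (suc m) j) ⟩
    s + (binomialSum a (b ∘ suc) n m (suc j) + t (suc (suc m) ℕ.+ j))
      ≡⟨ ℤ.+-assoc s _ _ ⟨
    s + binomialSum a (b ∘ suc) n m (suc j) + t (suc (suc m) ℕ.+ j) ∎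
    where
    open ≡-Reasoning
    s = + (n C j) * (a j * b (suc (suc m)))
    t : ℕ → ℤ
    t l = + (n C l) * (a l * b 0)

  binomialSum-pascal : ∀ a b n m j → binomialSum a b (suc n) m (suc j) ≡
    binomialSum (a ∘ suc) b n m j + binomialSum a b n m (suc j)
  binomialSum-pascal a b n m j = go m j
    where
    split : ∀ j x → + (suc n C suc j) * x ≡ + (n C j) * x + + (n C suc j) * x
    split j x = trans (cong (λ u → + u * x) (sym (nCk+nC[k+1]≡[n+1]C[k+1] n j)))
                      (ℤ.*-distribʳ-+ x (+ (n C j)) (+ (n C suc j)))

    go : ∀ m j → binomialSum a b (suc n) m (suc j) ≡
         binomialSum (a ∘ suc) b n m j + binomialSum a b n m (suc j)
    go zero    j = split j _
    go (suc m) j = trans (cong₂ _+_ (split j _) (go m (suc j)))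
                         (+-interchange (+ (n C j) * _) _ _ _)

  -- Pascal's rule for the coefficients matches the Leibniz rule. The explicit sum gives access to
  -- single binomial coefficients, for `frobenius` and for the recurrence of `U`.
  ⋆-binomialSum : ∀ n a b → (a ⋆ b) n ≡ binomialSum a b n n 0
  ⋆-binomialSum zero    a b = sym (ℤ.*-identityˡ (a 0 * b 0))
  ⋆-binomialSum (suc n) a b = begin
    (a ∘ suc ⋆ b) n + (a ⋆ b ∘ suc) n
      ≡⟨ cong₂ _+_ (⋆-binomialSum n (a ∘ suc) b) (⋆-binomialSum n a (b ∘ suc)) ⟩
    s + binomialSum a (b ∘ suc) n n 0
      -- A term with coefficient C(n, n+1) = 0 is added, so that `binomialSum-last` can reassemble
      -- the sum.
      ≡⟨ cong (_+_ s) (ℤ.+-identityʳ _) ⟨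
    s + (binomialSum a (b ∘ suc) n n 0 + 0ℤ)
      ≡⟨ cong (λ x → s + (binomialSum a (b ∘ suc) n n 0 + x)) last≡0 ⟨
    s + (binomialSum a (b ∘ suc) n n 0 + + (n C (suc n ℕ.+ 0)) * (a (suc n ℕ.+ 0) * b 0))
      ≡⟨ cong (_+_ s) (binomialSum-last a b n n 0) ⟨
    s + binomialSum a b n (suc n) 0
      ≡⟨ lemma s t (binomialSum a b n n 1) ⟩
    t + (s + binomialSum a b n n 1)
      ≡⟨ cong (_+_ t) (binomialSum-pascal a b n n 0) ⟨
    binomialSum a b (suc n) (suc n) 0 ∎
    where
    open ≡-Reasoning
    s = binomialSum (a ∘ suc) b n n 0
    t = 1ℤ * (a 0 * b (suc n))

    last≡0 : + (n C (suc n ℕ.+ 0)) * (a (suc n ℕ.+ 0) * b 0) ≡ 0ℤ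
    last≡0 = cong (λ u → + u * (a (suc n ℕ.+ 0) * b 0))
                  (k>n⇒nCk≡0 (ℕ.m≤m+n (suc n) 0))

    lemma : ∀ x y z → x + (y + z) ≡ y + (x + z)
    lemma = solve-∀

  -- Binomial coefficients modulo a prime.

  [1+k]*[1+n]C[1+k]≡[1+n]*nCk : ∀ n k → suc k ℕ.* (suc n C suc k) ≡ suc n ℕ.* (n C k)
  [1+k]*[1+n]C[1+k]≡[1+n]*nCk zero    zero    = refl
  [1+k]*[1+n]C[1+k]≡[1+n]*nCk zero    (suc k) = ℕ.*-zeroʳ k
  [1+k]*[1+n]C[1+k]≡[1+n]*nCk (suc n) zero    = begin
    1 ℕ.* (suc (suc n) C 1)              ≡⟨ cong (1 ℕ.*_) (nCk+nC[k+1]≡[n+1]C[k+1] (suc n) 0) ⟨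
    1 ℕ.* (1 ℕ.+ (suc n C 1))            ≡⟨ ℕ.*-distribˡ-+ 1 1 (suc n C 1) ⟩
    1 ℕ.+ 1 ℕ.* (suc n C 1)              ≡⟨ cong suc ([1+k]*[1+n]C[1+k]≡[1+n]*nCk n 0) ⟩
    1 ℕ.+ suc n ℕ.* 1                    ≡⟨⟩
    suc (suc n) ℕ.* (suc n C 0) ∎
    where open ≡-Reasoning
  [1+k]*[1+n]C[1+k]≡[1+n]*nCk (suc n) (suc k) = begin
    suc (suc k) ℕ.* (suc (suc n) C suc (suc k))
      ≡⟨ cong (suc (suc k) ℕ.*_) (nCk+nC[k+1]≡[n+1]C[k+1] (suc n) (suc k)) ⟨
    suc (suc k) ℕ.* (x ℕ.+ (suc n C suc (suc k)))
      ≡⟨ lemma₁ k x (suc n C suc (suc k)) ⟩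
    x ℕ.+ suc k ℕ.* x ℕ.+ suc (suc k) ℕ.* (suc n C suc (suc k))
      ≡⟨ cong₂ (λ u v → x ℕ.+ u ℕ.+ v) ([1+k]*[1+n]C[1+k]≡[1+n]*nCk n k)
                                       ([1+k]*[1+n]C[1+k]≡[1+n]*nCk n (suc k)) ⟩
    x ℕ.+ suc n ℕ.* (n C k) ℕ.+ suc n ℕ.* (n C suc k)
      ≡⟨ lemma₂ n x (n C k) (n C suc k) ⟩
    x ℕ.+ suc n ℕ.* ((n C k) ℕ.+ (n C suc k))
      ≡⟨ cong (λ u → x ℕ.+ suc n ℕ.* u) (nCk+nC[k+1]≡[n+1]C[k+1] n k) ⟩
    suc (suc n) ℕ.* x ∎
    where
    open ≡-Reasoning
    x = suc n C suc k

    lemma₁ : ∀ k x y → suc (suc k) ℕ.* (x ℕ.+ y) ≡ x ℕ.+ suc k ℕ.* x ℕ.+ suc (suc k) ℕ.* y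
    lemma₁ = ℕ-solve-∀

    lemma₂ : ∀ n x y z → x ℕ.+ suc n ℕ.* y ℕ.+ suc n ℕ.* z ≡ x ℕ.+ suc n ℕ.* (y ℕ.+ z)
    lemma₂ = ℕ-solve-∀

  -- p divides k C(p, k) = p C(p-1, k-1), and it does not divide k.
  prime∣C : ∀ {p k} → Prime p → 0 ℕ.< k → k ℕ.< p → p ℕ.∣ p C k
  prime∣C {suc n} {suc k} p-prime _ k<p
    with euclidsLemma (suc k) (suc n C suc k) p-prime
           (ℕ.divides (n C k) (trans ([1+k]*[1+n]C[1+k]≡[1+n]*nCk n k) (ℕ.*-comm (suc n) (n C k))))
  ... | inj₁ p∣k = contradiction p∣k (ℕ.>⇒∤ k<p)
  ... | inj₂ p∣C = p∣C

  -- Finite sums and congruences.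

  ∑< : ℕ → (ℕ → ℤ) → ℤ
  ∑< n f = foldr _+_ 0ℤ (applyUpTo f n)

  ∑<-distrib-* : ∀ n x f → ∑< n (λ i → x * f i) ≡ x * ∑< n f
  ∑<-distrib-* zero    x f = sym (ℤ.*-zeroʳ x)
  ∑<-distrib-* (suc n) x f = trans
    (cong (_+_ (x * f 0)) (∑<-distrib-* n x (f ∘ suc)))
    (sym (ℤ.*-distribˡ-+ x (f 0) _))

  ∑<-++ : ∀ m n f → ∑< (m ℕ.+ n) f ≡ ∑< m f + ∑< n (λ i → f (m ℕ.+ i))
  ∑<-++ zero    n f = sym (ℤ.+-identityˡ _)
  ∑<-++ (suc m) n f = trans
    (cong (_+_ (f 0)) (∑<-++ m n (f ∘ suc)))
    (sym (ℤ.+-assoc (f 0) _ _))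

  ∑<-last : ∀ n f → ∑< (suc n) f ≡ ∑< n f + f n
  ∑<-last zero    f = ℤ.+-comm (f 0) 0ℤ
  ∑<-last (suc n) f = trans
    (cong (_+_ (f 0)) (∑<-last n (f ∘ suc)))
    (sym (ℤ.+-assoc (f 0) _ _))

  ∑<-even-odd : ∀ n f → ∑< (n ℕ.* 2) f ≡ ∑< n (λ i → f (i ℕ.* 2)) + ∑< n (λ i → f (suc (i ℕ.* 2)))
  ∑<-even-odd zero    f = refl
  ∑<-even-odd (suc n) f = trans
    (cong (λ u → f 0 + (f 1 + u)) (∑<-even-odd n (f ∘ suc ∘ suc)))
    (lemma (f 0) (f 1) _ _)
    where
    lemma : ∀ w x y z → w + (x + (y + z)) ≡ (w + y) + (x + z)
    lemma = solve-∀

  module Congruence (p : ℕ) where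

    infix 4 _≈_

    -- A record instead of a bare divisibility, so that `x` and `y` can be inferred from the type.
    record _≈_ (x y : ℤ) : Set where
      constructor mod
      field p∣x-y : + p ℤ.∣ x - y
    open _≈_ public

    private
      variable
        w x y z : ℤ

    ≈-reflexive : x ≡ y → x ≈ y
    ≈-reflexive {x} refl = mod (divides 0ℤ (ℤ.+-inverseʳ x))

    ≈-refl : x ≈ x
    ≈-refl = ≈-reflexive refl

    -- The usual way below to pass from one congruence to another: the new difference is exhibited
    -- as a multiple of the known one by a polynomial identity.
    ≈-scale : ∀ c → y - z ≡ c * (w - x) → w ≈ x → y ≈ z
    ≈-scale c eq (mod p∣) = mod (subst (+ p ℤ.∣_) (sym eq) (ℤ.∣n⇒∣m*n c p∣))

    ≈-sym : x ≈ y → y ≈ x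
    ≈-sym {x} {y} = ≈-scale -1ℤ (lemma x y)
      where
      lemma : ∀ x y → y - x ≡ -1ℤ * (x - y)
      lemma = solve-∀

    ≈-trans : x ≈ y → y ≈ z → x ≈ z
    ≈-trans {x} {y} {z} (mod p∣) (mod q∣) = mod (subst (+ p ℤ.∣_) (lemma x y z) (ℤ.∣m∣n⇒∣m+n p∣ q∣))
      where
      lemma : ∀ x y z → (x - y) + (y - z) ≡ x - z
      lemma = solve-∀

    +-cong : w ≈ x → y ≈ z → w + y ≈ x + z
    +-cong {w} {x} {y} {z} (mod p∣) (mod q∣) =
      mod (subst (+ p ℤ.∣_) (lemma w x y z) (ℤ.∣m∣n⇒∣m+n p∣ q∣))
      where
      lemma : ∀ w x y z → (w - x) + (y - z) ≡ (w + y) - (x + z)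
      lemma = solve-∀

    +-congˡ : ∀ z → x ≈ y → z + x ≈ z + y
    +-congˡ z = +-cong (≈-refl {z})

    *-congˡ : ∀ z → x ≈ y → z * x ≈ z * y
    *-congˡ {x} {y} z = ≈-scale z (lemma x y z)
      where
      lemma : ∀ x y z → z * x - z * y ≡ z * (x - y)
      lemma = solve-∀

    *-congʳ : ∀ z → x ≈ y → x * z ≈ y * z
    *-congʳ {x} {y} z = ≈-scale z (lemma x y z)
      where
      lemma : ∀ x y z → x * z - y * z ≡ z * (x - y)
      lemma = solve-∀

    *-cong : w ≈ x → y ≈ z → w * y ≈ x * z
    *-cong {w} {x} {y} {z} w≈x y≈z = ≈-trans (*-congˡ w y≈z) (*-congʳ z w≈x)

    ‿-cong : w ≈ x → y ≈ z → w - y ≈ x - z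
    ‿-cong {w} {x} {y} {z} w≈x y≈z = +-cong w≈x (≈-scale -1ℤ (lemma y z) y≈z)
      where
      lemma : ∀ y z → - y - - z ≡ -1ℤ * (y - z)
      lemma = solve-∀

    ^-cong : ∀ n → x ≈ y → x ^ n ≈ y ^ n
    ^-cong zero    x≈y = ≈-refl
    ^-cong (suc n) x≈y = *-cong x≈y (^-cong n x≈y)

    ≈-setoid : Setoid _ _
    ≈-setoid = record
      { _≈_ = _≈_
      ; isEquivalence = record { refl = ≈-refl ; sym = ≈-sym ; trans = ≈-trans }
      }

    module ≈-Reasoning = SetoidReasoning ≈-setoid

    p≈0 : + p ≈ 0ℤ
    p≈0 = mod (divides 1ℤ (lemma (+ p)))
      where
      lemma : ∀ x → x - 0ℤ ≡ 1ℤ * x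
      lemma = solve-∀

    ∣⇒≈0 : ∀ {n} → p ℕ.∣ n → + n ≈ 0ℤ
    ∣⇒≈0 {n} p∣n = mod (subst (+ p ℤ.∣_) (sym (ℤ.+-identityʳ (+ n))) (ℤ.∣ᵤ⇒∣ p∣n))

    ∑<-cong : ∀ n {f g} → (∀ i → i ℕ.< n → f i ≈ g i) → ∑< n f ≈ ∑< n g
    ∑<-cong zero    f≈g = ≈-refl
    ∑<-cong (suc n) f≈g = +-cong (f≈g 0 ℕ.z<s) (∑<-cong n (λ i i<n → f≈g (suc i) (ℕ.s<s i<n)))

    ∑<-zero : ∀ n {f} → (∀ i → i ℕ.< n → f i ≈ 0ℤ) → ∑< n f ≈ 0ℤ
    ∑<-zero zero    f≈0 = ≈-refl
    ∑<-zero (suc n) f≈0 = +-cong (f≈0 0 ℕ.z<s) (∑<-zero n (λ i i<n → f≈0 (suc i) (ℕ.s<s i<n)))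

    -- Pairing the indices by an equation avoids truncated subtraction in the reflected index.
    ∑<-reverse : ∀ n {f g} → (∀ i j → suc (i ℕ.+ j) ≡ n → f i ≈ g j) → ∑< n f ≈ ∑< n g
    ∑<-reverse zero    f≈g = ≈-refl
    ∑<-reverse (suc n) {f} {g} f≈g = begin
      f 0 + ∑< n (f ∘ suc)
        ≈⟨ +-cong (f≈g 0 n refl) (∑<-reverse n (λ i j eq → f≈g (suc i) j (cong suc eq))) ⟩
      g n + ∑< n g
        ≡⟨ ℤ.+-comm (g n) (∑< n g) ⟩
      ∑< n g + g n
        ≡⟨ ∑<-last n g ⟨
      ∑< (suc n) g ∎
      where open ≈-Reasoning

    ⋆-cong : ∀ n {a a′ b b′} → (∀ i → a i ≈ a′ i) → (∀ i → b i ≈ b′ i) → (a ⋆ b) n ≈ (a′ ⋆ b′) n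
    ⋆-cong zero    a≈a′ b≈b′ = *-cong (a≈a′ 0) (b≈b′ 0)
    ⋆-cong (suc n) a≈a′ b≈b′ = +-cong (⋆-cong n (a≈a′ ∘ suc) b≈b′) (⋆-cong n a≈a′ (b≈b′ ∘ suc))

    -- In the binomial expansion every term of index below m has a vanishing factor; the one left
    -- has coefficient C(m, m) = 1.
    ⋆-first : ∀ m {a} b → (∀ i → i ℕ.< m → a i ≈ 0ℤ) → (a ⋆ b) m ≈ a m * b 0
    ⋆-first zero    b a≈0 = ≈-refl
    ⋆-first (suc m) {a} b a≈0 = begin
      (a ∘ suc ⋆ b) m + (a ⋆ b ∘ suc) m
        ≈⟨ +-cong (⋆-first m b (λ i i<m → a≈0 (suc i) (ℕ.s<s i<m)))
                  (⋆-first m (b ∘ suc) (λ i i<m → a≈0 i (ℕ.m<n⇒m<1+n i<m))) ⟩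
      a (suc m) * b 0 + a m * b 1
        ≈⟨ +-congˡ (a (suc m) * b 0) (*-congʳ (b 1) (a≈0 m ℕ.≤-refl)) ⟩
      a (suc m) * b 0 + 0ℤ
        ≡⟨ ℤ.+-identityʳ _ ⟩
      a (suc m) * b 0 ∎
      where open ≈-Reasoning

    -- Two terms of the expansion survive, with coefficients C(m+1, m+1) = 1 and C(m+1, m) = m+1.
    ⋆-first-two : ∀ m {a} b → (∀ i → i ℕ.< m → a i ≈ 0ℤ) →
                  (a ⋆ b) (suc m) ≈ a (suc m) * b 0 + + (suc m) * (a m * b 1)
    ⋆-first-two zero {a} b a≈0 = ≈-reflexive (cong (_+_ (a 1 * b 0)) (sym (ℤ.*-identityˡ (a 0 * b 1))))
    ⋆-first-two (suc m) {a} b a≈0 = begin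
      (a ∘ suc ⋆ b) (suc m) + (a ⋆ b ∘ suc) (suc m)
        ≈⟨ +-cong (⋆-first-two m b (λ i i<m → a≈0 (suc i) (ℕ.s<s i<m)))
                  (⋆-first (suc m) (b ∘ suc) a≈0) ⟩
      a (suc (suc m)) * b 0 + + (suc m) * (a (suc m) * b 1) + a (suc m) * b 1
        ≡⟨ lemma (a (suc (suc m)) * b 0) (+ (suc m)) (a (suc m) * b 1) ⟩
      a (suc (suc m)) * b 0 + + (suc (suc m)) * (a (suc m) * b 1) ∎
      where
      open ≈-Reasoning
      lemma : ∀ x y z → x + y * z + z ≡ x + (1ℤ + y) * z
      lemma = solve-∀

  -- Power sums and the Frobenius congruence.

  ⋆-zeroˡ : ∀ n b → ((λ _ → 0ℤ) ⋆ b) n ≡ 0ℤ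
  ⋆-zeroˡ zero    b = refl
  ⋆-zeroˡ (suc n) b = cong₂ _+_ (⋆-zeroˡ n b) (⋆-zeroˡ n (b ∘ suc))

  ⋆-∑<ˡ : ∀ n N (f : ℕ → ℕ → ℤ) b →
          ((λ i → ∑< N (λ x → f x i)) ⋆ b) n ≡ ∑< N (λ x → (f x ⋆ b) n)
  ⋆-∑<ˡ n zero    f b = ⋆-zeroˡ n b
  ⋆-∑<ˡ n (suc N) f b = trans (⋆-distribʳ-+ n (f 0) _ b) (cong (_+_ ((f 0 ⋆ b) n)) (⋆-∑<ˡ n N (f ∘ suc) b))

  -- The term x = 0 is 1 for i = 0.
  powers : ℕ → ℕ → ℤ
  powers N i = ∑< N (λ x → (+ x) ^ i)

  -- Multiplying ∑ e^{xt} by e^t replaces each x by x + 1, which moves the range from 0, ..., N-1 to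
  -- 1, ..., N.
  powers-⋆-exp1 : ∀ N n → (powers N ⋆ exp 1ℤ) (suc n) ≡ powers N (suc n) + (+ N) ^ suc n
  powers-⋆-exp1 N n = begin
    (powers N ⋆ exp 1ℤ) (suc n)
      ≡⟨ ⋆-∑<ˡ (suc n) N (λ x → exp (+ x)) (exp 1ℤ) ⟩
    ∑< N (λ x → (exp (+ x) ⋆ exp 1ℤ) (suc n))
      ≡⟨ cong (foldr _+_ 0ℤ) (applyUpTo-cong N λ x → trans (⋆-exp (suc n) (+ x) 1ℤ)
           (cong (_^ suc n) (ℤ.+-comm (+ x) 1ℤ))) ⟩
    ∑< N (λ x → (+ suc x) ^ suc n)
      -- The term x = 0 inserted here computes to 0, the exponent being positive.
      ≡⟨ ℤ.+-identityˡ _ ⟨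
    powers (suc N) (suc n)
      ≡⟨ ∑<-last N (λ x → (+ x) ^ suc n) ⟩
    powers N (suc n) + (+ N) ^ suc n ∎
    where
    open ≡-Reasoning
    applyUpTo-cong : ∀ N {f g : ℕ → ℤ} → (∀ x → f x ≡ g x) → applyUpTo f N ≡ applyUpTo g N
    applyUpTo-cong zero    f≡g = refl
    applyUpTo-cong (suc N) f≡g = cong₂ _∷_ (f≡g 0) (applyUpTo-cong N (f≡g ∘ suc))

  -- The inner coefficients C(p, j) are divisible by p, so only the two ends of the binomial sum
  -- survive.
  frobenius : ∀ {p} → Prime p → let open Congruence p in
              ∀ a b → (a ⋆ b) p ≈ a 0 * b p + a p * b 0
  frobenius {p@(suc q)} p-prime a b = begin
    (a ⋆ b) p
      ≡⟨ ⋆-binomialSum p a b ⟩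
    1ℤ * (a 0 * b p) + binomialSum a b p q 1
      ≈⟨ +-cong (≈-reflexive (ℤ.*-identityˡ (a 0 * b p))) (top q 0 (ℕ.+-comm q 1)) ⟩
    a 0 * b p + a p * b 0 ∎
    where
    open Congruence p
    open ≈-Reasoning

    top : ∀ m j → m ℕ.+ suc j ≡ p → binomialSum a b p m (suc j) ≈ a p * b 0
    top zero    j refl = ≈-reflexive (trans (cong (λ u → + u * (a p * b 0)) (nCn≡1 p))
                                            (ℤ.*-identityˡ (a p * b 0)))
    top (suc m) j eq = begin
      + (p C suc j) * x + binomialSum a b p m (suc (suc j))
        ≈⟨ +-cong (*-congʳ x (∣⇒≈0 (prime∣C p-prime ℕ.z<s j<p)))
                  (top m (suc j) (trans (ℕ.+-suc m (suc j)) eq)) ⟩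
      0ℤ * x + a p * b 0
        ≡⟨ cong (_+ a p * b 0) (ℤ.*-zeroˡ x) ⟩
      0ℤ + a p * b 0
        ≡⟨ ℤ.+-identityˡ _ ⟩
      a p * b 0 ∎
      where
      x = a (suc j) * b (suc m)
      j<p : suc j ℕ.< p
      j<p = subst (suc (suc j) ℕ.≤_) eq (ℕ.s≤s (ℕ.m≤n+m (suc j) m))

  -- Arithmetic modulo a prime.

  module PrimeModulus (p : ℕ) (p-prime : Prime p) where

    open Congruence p

    private
      instance
        _ = prime⇒nonZero p-prime

    *-cancelˡ : ∀ d {x y} → ¬ p ℕ.∣ d → + d * x ≈ + d * y → x ≈ y
    *-cancelˡ d {x} {y} p∤d (mod p∣) with euclidsLemma d ∣ x - y ∣ p-prime
      (subst (p ℕ.∣_) (ℤ.abs-* (+ d) (x - y)) (ℤ.∣⇒∣ᵤ (subst (+ p ℤ.∣_) (lemma (+ d) x y) p∣)))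
      where
      lemma : ∀ d x y → d * x - d * y ≡ d * (x - y)
      lemma = solve-∀
    ... | inj₁ p∣d   = contradiction p∣d p∤d
    ... | inj₂ p∣x-y = mod (ℤ.∣ᵤ⇒∣ p∣x-y)

    -- Induction on x, with (1 + x)^p ≡ 1 + x^p from `frobenius`.
    fermat : ∀ x → (+ x) ^ p ≈ + x
    fermat zero    = ≈-reflexive (cong (0ℤ ^_) (sym (ℕ.suc-pred p)))
    fermat (suc x) = begin
      (1ℤ + + x) ^ p
        ≡⟨ ⋆-exp p 1ℤ (+ x) ⟨
      (exp 1ℤ ⋆ exp (+ x)) p
        ≈⟨ frobenius p-prime (exp 1ℤ) (exp (+ x)) ⟩
      1ℤ * (+ x) ^ p + 1ℤ ^ p * 1ℤ
        ≡⟨ cong (λ u → 1ℤ * (+ x) ^ p + u * 1ℤ) (ℤ.^-zeroˡ p) ⟩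
      1ℤ * (+ x) ^ p + 1ℤ
        ≈⟨ +-cong (*-congˡ 1ℤ (fermat x)) (≈-refl {1ℤ}) ⟩
      1ℤ * + x + 1ℤ
        ≡⟨ lemma (+ x) ⟩
      1ℤ + + x ∎
      where
      open ≈-Reasoning
      lemma : ∀ x → 1ℤ * x + 1ℤ ≡ 1ℤ + x
      lemma = solve-∀

    fermat-little : ∀ x → ¬ p ℕ.∣ x → (+ x) ^ ℕ.pred p ≈ 1ℤ
    fermat-little x p∤x = *-cancelˡ x p∤x (begin
      + x * (+ x) ^ ℕ.pred p ≡⟨ cong ((+ x) ^_) (ℕ.suc-pred p) ⟩
      (+ x) ^ p              ≈⟨ fermat x ⟩
      + x                    ≡⟨ ℤ.*-identityʳ (+ x) ⟨
      + x * 1ℤ               ∎)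
      where open ≈-Reasoning

    -- Summing (x+1)^{j+1} - x^{j+1} over x < p and expanding gives (j+1) ∑ x^j ≡ 0
    -- once all lower power sums vanish.
    powers≈0 : ∀ j → suc j ℕ.< p → powers p j ≈ 0ℤ
    powers≈0 j = go (suc j) j ℕ.≤-refl
      where
      open ≈-Reasoning

      lemma : ∀ s t u → u * t - u * 0ℤ ≡ 1ℤ * ((s * 1ℤ + u * (t * 1ℤ)) - (s + 0ℤ))
      lemma = solve-∀

      -- `N` bounds `j`, so that recursion on it is strong induction on `j`.
      go : ∀ N j → j ℕ.< N → suc j ℕ.< p → powers p j ≈ 0ℤ
      go (suc N) j (ℕ.s≤s j≤N) j+1<p =
        *-cancelˡ (suc j) (ℕ.>⇒∤ j+1<p)
          (≈-scale 1ℤ (lemma (powers p (suc j)) (powers p j) (+ suc j)) (begin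
            powers p (suc j) * 1ℤ + + suc j * (powers p j * 1ℤ)
              ≈⟨ ⋆-first-two j (exp 1ℤ) (λ i i<j → go N i (ℕ.<-≤-trans i<j j≤N)
                   (ℕ.<-trans (ℕ.s<s i<j) j+1<p)) ⟨
            (powers p ⋆ exp 1ℤ) (suc j)
              ≡⟨ powers-⋆-exp1 p j ⟩
            powers p (suc j) + (+ p) ^ suc j
              ≈⟨ +-congˡ (powers p (suc j)) (*-congʳ ((+ p) ^ j) p≈0) ⟩
            powers p (suc j) + 0ℤ ∎))

  -- The sequence U

  -- The generating function of U is the inverse of e^t + e^{-t} - 1.
  U⁻¹ : ℕ → ℤ
  U⁻¹ i = (exp 1ℤ i + exp -1ℤ i) + -1ℤ * exp 0ℤ i

  [-1]^[2*j]≡1 : ∀ j → -1ℤ ^ (2 ℕ.* j) ≡ 1ℤ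
  [-1]^[2*j]≡1 j = trans (sym (ℤ.^-*-assoc -1ℤ 2 j)) (ℤ.^-zeroˡ j)

  -- Index 0 is left out: there `exp 0ℤ` contributes and the value is 1.
  U⁻¹-even : ∀ j → U⁻¹ (2 ℕ.* suc j) ≡ + 2
  U⁻¹-even j = cong₂ (λ u v → (u + v) + 0ℤ) (ℤ.^-zeroˡ (2 ℕ.* suc j)) ([-1]^[2*j]≡1 (suc j))

  U⁻¹-odd : ∀ j → U⁻¹ (suc (2 ℕ.* j)) ≡ 0ℤ
  U⁻¹-odd j = cong₂ (λ u v → (u + -1ℤ * v) + 0ℤ) (ℤ.^-zeroˡ (suc (2 ℕ.* j))) ([-1]^[2*j]≡1 j)

  -- The coefficients of `U⁻¹` at odd indices vanish and those at positive even indices are 2, so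
  -- every other term drops out and `m` descends by 2 in step with `U-sum`.
  binomialSum-U : ∀ n m j → binomialSum U⁻¹ U n m (2 ℕ.* suc j) ≡ + 2 * U-sum n (suc (suc m)) (suc j)
  binomialSum-U n m j = go m
    where
    even : ∀ x → + (n C (2 ℕ.* suc j)) * (U⁻¹ (2 ℕ.* suc j) * x) ≡
                 + 2 * (+ (n C (2 ℕ.* suc j)) * x)
    even x = trans (cong (λ u → + (n C (2 ℕ.* suc j)) * (u * x)) (U⁻¹-even j))
                   (lemma (+ (n C (2 ℕ.* suc j))) x)
      where
      lemma : ∀ x y → x * (+ 2 * y) ≡ + 2 * (x * y)
      lemma = solve-∀

    odd : ∀ x → + (n C suc (2 ℕ.* suc j)) * (U⁻¹ (suc (2 ℕ.* suc j)) * x) ≡ 0ℤ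
    odd x = trans (cong (λ u → + (n C suc (2 ℕ.* suc j)) * (u * x)) (U⁻¹-odd (suc j)))
                  (ℤ.*-zeroʳ (+ (n C suc (2 ℕ.* suc j))))

    lemma₁ : ∀ x → + 2 * x ≡ + 2 * (x + 0ℤ)
    lemma₁ = solve-∀

    lemma₂ : ∀ x y → + 2 * x + (0ℤ + + 2 * y) ≡ + 2 * (x + y)
    lemma₂ = solve-∀

    go : ∀ m → binomialSum U⁻¹ U n m (2 ℕ.* suc j) ≡ + 2 * U-sum n (suc (suc m)) (suc j)
    go zero          = trans (even 1ℤ) (lemma₁ _)
    go (suc zero)    = trans (cong₂ _+_ (even (U 1)) (odd 1ℤ))
      (trans (ℤ.+-identityʳ _) (lemma₁ (+ (n C (2 ℕ.* suc j)) * U 1)))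
    go (suc (suc m)) = begin
      binomialSum U⁻¹ U n (suc (suc m)) (2 ℕ.* suc j)
        ≡⟨ cong₂ _+_ (even _) (cong₂ _+_ (odd _)
             (trans (cong (binomialSum U⁻¹ U n m) (sym (ℕ.*-suc 2 (suc j))))
                    (binomialSum-U n m (suc j)))) ⟩
      + 2 * x + (0ℤ + + 2 * U-sum n (suc (suc m)) (suc (suc j)))
        ≡⟨ lemma₂ x _ ⟩
      + 2 * U-sum n (suc (suc (suc (suc m)))) (suc j) ∎
      where
      open ≡-Reasoning
      x = + (n C (2 ℕ.* suc j)) * U (suc (suc m))

  -- The recurrence of `U` says that the product has no coefficients of positive index: index 0 of
  -- `U⁻¹` contributes U_n, the even ones twice the sum in the recurrence.
  U⁻¹⋆U≡1 : ∀ n → (U⁻¹ ⋆ U) n ≡ exp 0ℤ n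
  U⁻¹⋆U≡1 zero          = refl
  U⁻¹⋆U≡1 (suc zero)    = refl
  U⁻¹⋆U≡1 (suc (suc n)) = begin
    (U⁻¹ ⋆ U) N
      ≡⟨ ⋆-binomialSum N U⁻¹ U ⟩
    1ℤ * (1ℤ * U N) + (+ (N C 1) * (0ℤ * U (suc n)) + binomialSum U⁻¹ U N n 2)
      ≡⟨ cong (λ u → 1ℤ * (1ℤ * U N) + (+ (N C 1) * 0ℤ + u)) (binomialSum-U N n 0) ⟩
    1ℤ * (1ℤ * (-[2] * U-sum N N 1)) + (+ (N C 1) * 0ℤ + + 2 * U-sum N N 1)
      ≡⟨ lemma (U-sum N N 1) (+ (N C 1)) ⟩
    0ℤ
      ≡⟨ ℤ.*-zeroˡ (exp 0ℤ (suc n)) ⟨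
    exp 0ℤ N ∎
    where
    open ≡-Reasoning
    N = suc (suc n)
    -[2] = - + 2
    lemma : ∀ x y → 1ℤ * (1ℤ * (- + 2 * x)) + (y * 0ℤ + + 2 * x) ≡ 0ℤ
    lemma = solve-∀

  -- Generating function e^{xt} / (e^t + e^{-t} - 1) in n.
  V : ℕ → ℤ → ℤ
  V n x = (exp x ⋆ U) n

  -- Multiplying e^{xt} by e^t + 1/e^t - 1 gives the combination of exponentials on the left; the
  -- factor then cancels against the generating function of `U`.
  V-rec : ∀ n x → (V n (x + 1ℤ) + V n (x + -1ℤ)) + -1ℤ * V n x ≡ x ^ n
  V-rec n x = ≈0⇒≡ (begin
    (V n (x + 1ℤ) + V n (x + -1ℤ)) + -1ℤ * V n x
      ≡⟨ cong₂ _+_ (⋆-distribʳ-+ n _ _ U) (⋆-scaleˡ n -1ℤ (exp x) U) ⟨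
    ((λ i → exp (x + 1ℤ) i + exp (x + -1ℤ) i) ⋆ U) n + ((λ i → -1ℤ * exp x i) ⋆ U) n
      ≡⟨ ⋆-distribʳ-+ n _ _ U ⟨
    ((λ i → (exp (x + 1ℤ) i + exp (x + -1ℤ) i) + -1ℤ * exp x i) ⋆ U) n
      ≈⟨ ⋆-cong n (λ i → ≈-reflexive (exp⋆U⁻¹ i)) (λ i → ≈-refl) ⟨
    ((exp x ⋆ U⁻¹) ⋆ U) n
      ≡⟨ ⋆-assoc n (exp x) U⁻¹ U ⟩
    (exp x ⋆ (U⁻¹ ⋆ U)) n
      ≈⟨ ⋆-cong n (λ i → ≈-refl) (λ i → ≈-reflexive (U⁻¹⋆U≡1 i)) ⟩
    (exp x ⋆ exp 0ℤ) n
      ≡⟨ ⋆-identityʳ n (exp x) ⟩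
    x ^ n ∎)
    where
    -- Congruence modulo 0 is equality; this gives access to ⋆-cong.
    open Congruence 0
    open ≈-Reasoning

    ≈0⇒≡ : ∀ {x y} → x ≈ y → x ≡ y
    ≈0⇒≡ {x} {y} (mod 0∣) = ℤ.i-j≡0⇒i≡j x y (ℤ.0∣⇒≡0 0∣)

    exp⋆U⁻¹ : ∀ i → (exp x ⋆ U⁻¹) i ≡ (exp (x + 1ℤ) i + exp (x + -1ℤ) i) + -1ℤ * exp x i
    exp⋆U⁻¹ i = trans (⋆-distribˡ-+ i (exp x) _ _)
      (cong₂ _+_ (trans (⋆-distribˡ-+ i (exp x) _ _)
                        (cong₂ _+_ (⋆-exp i x 1ℤ) (⋆-exp i x -1ℤ)))
                 (trans (⋆-scaleʳ i -1ℤ (exp x) _)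
                        (cong (-1ℤ *_) (⋆-identityʳ i (exp x)))))

  V-0 : ∀ n → V n 0ℤ ≡ U n
  V-0 n = ⋆-identityˡ n U

  -- Sums of even powers modulo p

  ∑<-signed : ∀ N e f g h → ∑< N (λ i → e i - f i - g i + h i) ≡ ∑< N e - ∑< N f - ∑< N g + ∑< N h
  ∑<-signed zero    e f g h = refl
  ∑<-signed (suc N) e f g h = trans
    (cong (_+_ (e 0 - f 0 - g 0 + h 0)) (∑<-signed N (e ∘ suc) (f ∘ suc) (g ∘ suc) (h ∘ suc)))
    (lemma (e 0) (f 0) (g 0) (h 0) _ _ _ _)
    where
    lemma : ∀ a b c d e f g h → (a - b - c + d) + (e - f - g + h) ≡
                                (a + e) - (b + f) - (c + g) + (d + h)
    lemma = solve-∀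

  telescope : ∀ m d (w D : ℕ → ℤ) → (∀ j → w (d ℕ.+ j) ≡ w j + D j) →
              w (m ℕ.* d) ≡ w 0 + ∑< m (λ i → D (i ℕ.* d))
  telescope zero    d w D step = sym (ℤ.+-identityʳ (w 0))
  telescope (suc m) d w D step = begin
    w (d ℕ.+ m ℕ.* d)
      ≡⟨ telescope m d (w ∘ (d ℕ.+_)) (D ∘ (d ℕ.+_)) (step ∘ (d ℕ.+_)) ⟩
    w (d ℕ.+ 0) + ∑< m (λ i → D (d ℕ.+ i ℕ.* d))
      ≡⟨ cong (_+ ∑< m (λ i → D (d ℕ.+ i ℕ.* d))) (step 0) ⟩
    w 0 + D 0 + ∑< m (λ i → D (d ℕ.+ i ℕ.* d))
      ≡⟨ ℤ.+-assoc (w 0) (D 0) _ ⟩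
    w 0 + ∑< (suc m) (λ i → D (i ℕ.* d)) ∎
    where open ≡-Reasoning

  ^-neg-even : ∀ {n} x → 2 ℕ.∣ n → (- x) ^ n ≡ x ^ n
  ^-neg-even {n} x (ℕ.divides q n≡q*2) = begin
    (- x) ^ n           ≡⟨ cong ((- x) ^_) n≡2*q ⟩
    (- x) ^ (2 ℕ.* q)   ≡⟨ ℤ.^-*-assoc (- x) 2 q ⟨
    ((- x) ^ 2) ^ q     ≡⟨ cong (_^ q) (lemma x) ⟩
    (x ^ 2) ^ q         ≡⟨ ℤ.^-*-assoc x 2 q ⟩
    x ^ (2 ℕ.* q)       ≡⟨ cong (x ^_) n≡2*q ⟨
    x ^ n               ∎
    where
    open ≡-Reasoning
    n≡2*q : n ≡ 2 ℕ.* q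
    n≡2*q = trans n≡q*2 (ℕ.*-comm q 2)
    lemma : ∀ x → - x * (- x * 1ℤ) ≡ x * (x * 1ℤ)
    lemma = solve-∀

  module EvenPowers (p : ℕ) (p-prime : Prime p) (n : ℕ) (2∣n : 2 ℕ.∣ n) (0<n : 0 ℕ.< n) where

    open Congruence p
    open PrimeModulus p p-prime
    open ≈-Reasoning

    g : ℕ → ℤ
    g x = (+ x) ^ n

    g0≡0 : g 0 ≡ 0ℤ
    g0≡0 = cong (0ℤ ^_) (sym (ℕ.suc-pred n {{ℕ.>-nonZero 0<n}}))

    g-* : ∀ x y → g (x ℕ.* y) ≡ g x * g y
    g-* x y = trans (cong (_^ n) (ℤ.pos-* x y)) (^-distribʳ-* (+ x) (+ y) n)

    -- x is -y modulo p, and the exponent is even.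
    g-reflect : ∀ x y → x ℕ.+ y ≡ p → g x ≈ g y
    g-reflect x y x+y≡p = begin
      (+ x) ^ n    ≈⟨ ^-cong n (≈-scale 1ℤ (trans (lemma (+ x) (+ y)) (cong (λ u → 1ℤ * (+ u - 0ℤ)) x+y≡p)) p≈0) ⟩
      (- + y) ^ n  ≡⟨ ^-neg-even (+ y) 2∣n ⟩
      (+ y) ^ n    ∎
      where
      lemma : ∀ x y → x - - y ≡ 1ℤ * ((x + y) - 0ℤ)
      lemma = solve-∀

    ∑<-multiples : ∀ N d (f : ℕ → ℕ) → ∑< N (λ i → g (f i ℕ.* d)) ≈ g d * ∑< N (λ i → g (f i))
    ∑<-multiples N d f = begin
      ∑< N (λ i → g (f i ℕ.* d))
        ≈⟨ ∑<-cong N (λ i _ → ≈-reflexive (trans (g-* (f i) d) (ℤ.*-comm (g (f i)) (g d)))) ⟩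
      ∑< N (λ i → g d * g (f i))
        ≡⟨ ∑<-distrib-* N (g d) (λ i → g (f i)) ⟩
      g d * ∑< N (λ i → g (f i)) ∎

    sumTo : ℕ → ℤ
    sumTo N = ∑< N (g ∘ suc)

    sumOdd : ℕ → ℤ
    sumOdd N = ∑< N (λ i → g (suc (i ℕ.* 2)))

    -- V starts at the argument -1, so that telescoping can start at w 0.
    v w D : ℕ → ℤ
    v j = V n (+ j - 1ℤ)
    w j = v (suc j) - v j
    D j = g (5 ℕ.+ j) - g (3 ℕ.+ j) - g (2 ℕ.+ j) + g j

    -- This is `V-rec` at the argument j, where V(j+1), V(j), V(j-1) are the values of `v` at j+2,
    -- j+1, j.
    w-suc : ∀ j → w (suc j) ≡ g j - v j
    w-suc j = trans (lemma (v (suc (suc j))) (v (suc j)) (v j)) (cong (_- v j)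
      (trans (cong (λ u → (V n (+ u) + v j) + -1ℤ * v (suc j)) (ℕ.+-comm 1 j)) (V-rec n (+ j))))
      where
      lemma : ∀ x y z → x - y ≡ ((x + z) + -1ℤ * y) - z
      lemma = solve-∀

    -- Three steps give w(j+3) = -w(j) + (j+2)^n - j^n; six restore the sign. Behind this, the roots
    -- of X^2 - X + 1 are the primitive sixth roots of unity.
    w-step : ∀ j → w (6 ℕ.+ j) ≡ w j + D j
    w-step j =
      trans (w-suc (5 ℕ.+ j))
      (trans (cong (λ u → g (5 ℕ.+ j) - u) (trans (v-suc (3 ℕ.+ j)) (cong (_+ g (3 ℕ.+ j))
         (trans (w-suc (2 ℕ.+ j)) (cong (λ u → g (2 ℕ.+ j) - u) (v-suc j))))))
      (lemma₂ (w j) (g j) (g (2 ℕ.+ j)) (g (3 ℕ.+ j)) (g (5 ℕ.+ j))))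
      where
      lemma₁ : ∀ w g v′ v → v - v′ ≡ g - w → v ≡ v′ - w + g
      lemma₁ w g v′ v eq = trans (lemma v v′) (trans (cong (_+_ v′) eq) (lemma′ v′ g w))
        where
        lemma : ∀ v v′ → v ≡ v′ + (v - v′)
        lemma = solve-∀
        lemma′ : ∀ v g w → v + (g - w) ≡ v - w + g
        lemma′ = solve-∀

      v-suc : ∀ j → v (2 ℕ.+ j) ≡ w j + g j
      v-suc j = lemma₁ (v j) (g j) (v (suc j)) (v (2 ℕ.+ j)) (w-suc j)

      lemma₂ : ∀ w g₀ g₂ g₃ g₅ → g₅ - ((g₂ - (w + g₀)) + g₃) ≡ w + (g₅ - g₃ - g₂ + g₀)
      lemma₂ = solve-∀

    -- `V` is a polynomial with integer coefficients in its argument.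
    v-period : ∀ j → v (j ℕ.+ p) ≈ v j
    v-period j = ⋆-cong n (λ i → ^-cong i (≈-scale 1ℤ (lemma (+ j) (+ p)) p≈0)) (λ i → ≈-refl)
      where
      lemma : ∀ j p → (j + p - 1ℤ) - (j - 1ℤ) ≡ 1ℤ * (p - 0ℤ)
      lemma = solve-∀

    w-period : ∀ j → w (j ℕ.+ p) ≈ w j
    w-period j = ‿-cong (v-period (suc j)) (v-period j)

    class : ℕ → ℕ → ℤ
    class r N = ∑< N (λ i → g (r ℕ.+ i ℕ.* 6))

    -- The hypothesis says that the first term a of one class and the last term b + 6(N-1) of the
    -- other add up to p.
    class-reflect : ∀ N a b → a ℕ.+ b ℕ.+ N ℕ.* 6 ≡ 6 ℕ.+ p → class a N ≈ class b N
    class-reflect N a b eq = ∑<-reverse N λ i j i+j+1≡N →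
      g-reflect (a ℕ.+ i ℕ.* 6) (b ℕ.+ j ℕ.* 6) (ℕ.+-cancelˡ-≡ 6 _ _ (trans (ring a b i j)
        (trans (cong (λ u → a ℕ.+ b ℕ.+ u ℕ.* 6) i+j+1≡N) eq)))
      where
      ring : ∀ a b i j → 6 ℕ.+ ((a ℕ.+ i ℕ.* 6) ℕ.+ (b ℕ.+ j ℕ.* 6)) ≡ a ℕ.+ b ℕ.+ suc (i ℕ.+ j) ℕ.* 6
      ring = ℕ-solve-∀

    class-6 : ∀ N → class 6 N ≈ g 6 * sumTo N
    class-6 N = ∑<-multiples N 6 suc

    -- 3 + 6i is 3 times the odd number 1 + 2i.
    class-3 : ∀ N → class 3 N ≈ g 3 * sumOdd N
    class-3 N = ≈-trans
      (∑<-cong N (λ i _ → ≈-reflexive (cong (λ u → g (3 ℕ.+ u)) (sym (ℕ.*-assoc i 2 3)))))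
      (∑<-multiples N 3 (λ i → suc (i ℕ.* 2)))

    -- The hypothesis amounts to 2a + 6N = p + 1. The reflection of x to p - x then exchanges the
    -- classes of a and a+5 and those of a+2 and a+3, so the four sums in the telescoped `D`
    -- collapse to two, each counted twice.
    w-window : ∀ a N → 5 ℕ.+ (a ℕ.+ a) ℕ.+ N ℕ.* 6 ≡ 6 ℕ.+ p →
               w (a ℕ.+ N ℕ.* 6) - w a ≈ + 2 * (class (5 ℕ.+ a) N - class (3 ℕ.+ a) N)
    w-window a N eq = begin
      w (a ℕ.+ N ℕ.* 6) - w a
        ≡⟨ cong₂ _-_ (telescope N 6 (w ∘ (a ℕ.+_)) (D ∘ (a ℕ.+_)) step) (cong w (sym (ℕ.+-identityʳ a))) ⟩
      w (a ℕ.+ 0) + ∑< N (λ i → D (a ℕ.+ i ℕ.* 6)) - w (a ℕ.+ 0)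
        ≡⟨ lemma₁ (w (a ℕ.+ 0)) _ ⟩
      ∑< N (λ i → D (a ℕ.+ i ℕ.* 6))
        ≡⟨ ∑<-signed N (λ i → g (5 ℕ.+ a ℕ.+ i ℕ.* 6)) (λ i → g (3 ℕ.+ a ℕ.+ i ℕ.* 6))
                       (λ i → g (2 ℕ.+ a ℕ.+ i ℕ.* 6)) (λ i → g (a ℕ.+ i ℕ.* 6)) ⟩
      class (5 ℕ.+ a) N - class (3 ℕ.+ a) N - class (2 ℕ.+ a) N + class a N
        ≈⟨ +-cong (‿-cong (≈-refl {class (5 ℕ.+ a) N - class (3 ℕ.+ a) N})
                          (class-reflect N (2 ℕ.+ a) (3 ℕ.+ a) (trans (cong (ℕ._+ N ℕ.* 6) (ring a)) eq)))
                  (class-reflect N a (5 ℕ.+ a) (trans (cong (ℕ._+ N ℕ.* 6) (ring′ a)) eq)) ⟩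
      class (5 ℕ.+ a) N - class (3 ℕ.+ a) N - class (3 ℕ.+ a) N + class (5 ℕ.+ a) N
        ≡⟨ lemma₂ (class (5 ℕ.+ a) N) (class (3 ℕ.+ a) N) ⟩
      + 2 * (class (5 ℕ.+ a) N - class (3 ℕ.+ a) N) ∎
      where
      step : ∀ j → w (a ℕ.+ (6 ℕ.+ j)) ≡ w (a ℕ.+ j) + D (a ℕ.+ j)
      step j = trans (cong w (solution a j)) (w-step (a ℕ.+ j))
        where
        solution : ∀ a j → a ℕ.+ (6 ℕ.+ j) ≡ 6 ℕ.+ (a ℕ.+ j)
        solution = ℕ-solve-∀

      ring : ∀ a → (2 ℕ.+ a) ℕ.+ (3 ℕ.+ a) ≡ 5 ℕ.+ (a ℕ.+ a)
      ring = ℕ-solve-∀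

      ring′ : ∀ a → a ℕ.+ (5 ℕ.+ a) ≡ 5 ℕ.+ (a ℕ.+ a)
      ring′ = ℕ-solve-∀

      lemma₁ : ∀ w x → w + x - w ≡ x
      lemma₁ = solve-∀

      lemma₂ : ∀ x y → x - y - y + x ≡ + 2 * (x - y)
      lemma₂ = solve-∀

    -- As 0^n = 0, w(1) is -v(0), and the difference is v(1) = V(0).
    w0-w1≡U : w 0 - w 1 ≡ U n
    w0-w1≡U = trans
      (cong (_-_ (w 0)) (trans (w-suc 0) (cong (_- v 0) g0≡0)))
      (trans (lemma (v 1) (v 0)) (V-0 n))
      where
      lemma : ∀ x y → (x - y) - (0ℤ - y) ≡ x
      lemma = solve-∀

    -- The window from 1 ends at p, where w returns to w(0).
    U≈-1mod6 : ∀ s → p ≡ 1 ℕ.+ s ℕ.* 6 → U n ≈ + 2 * (g 6 * sumTo s - g 3 * sumOdd s)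
    U≈-1mod6 s p≡ = begin
      U n
        ≡⟨ w0-w1≡U ⟨
      w 0 - w 1
        ≈⟨ ‿-cong (w-period 0) (≈-refl {w 1}) ⟨
      w p - w 1
        ≡⟨ cong (λ u → w u - w 1) p≡ ⟩
      w (1 ℕ.+ s ℕ.* 6) - w 1
        ≈⟨ w-window 1 s (cong (6 ℕ.+_) (sym p≡)) ⟩
      + 2 * (class 6 s - class 4 s)
        ≈⟨ *-congˡ (+ 2) (‿-cong (class-6 s)
             (≈-trans (class-reflect s 4 3 (cong (6 ℕ.+_) (sym p≡))) (class-3 s))) ⟩
      + 2 * (g 6 * sumTo s - g 3 * sumOdd s) ∎

    -- The window from 0 ends at p + 1, where w returns to w(1). The difference appears in the
    -- opposite order, which is the source of the sign (p/3).
    -U≈-5mod6 : ∀ s → p ≡ 5 ℕ.+ s ℕ.* 6 → - U n ≈ + 2 * (g 6 * sumTo s - g 3 * sumOdd (suc s))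
    -U≈-5mod6 s p≡ = begin
      - U n
        ≡⟨ cong -_ w0-w1≡U ⟨
      - (w 0 - w 1)
        ≡⟨ lemma (w 0) (w 1) ⟩
      w 1 - w 0
        ≈⟨ ‿-cong (w-period 1) (≈-refl {w 0}) ⟨
      w (1 ℕ.+ p) - w 0
        ≡⟨ cong (λ u → w (1 ℕ.+ u) - w 0) p≡ ⟩
      w (suc s ℕ.* 6) - w 0
        ≈⟨ w-window 0 (suc s) 5+6[s+1]≡6+p ⟩
      + 2 * (class 5 (suc s) - class 3 (suc s))
        ≈⟨ *-congˡ (+ 2) (‿-cong
             -- The class of 5 reflects to that of 0, whose first term is 0 and whose others form
             -- the class started at 6.
             (≈-trans (class-reflect (suc s) 5 0 5+6[s+1]≡6+p)
                      (≈-trans (≈-reflexive (trans (cong (_+ class 6 s) g0≡0) (ℤ.+-identityˡ _))) (class-6 s)))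
             (class-3 (suc s))) ⟩
      + 2 * (g 6 * sumTo s - g 3 * sumOdd (suc s)) ∎
      where
      5+6[s+1]≡6+p : 5 ℕ.+ suc s ℕ.* 6 ≡ 6 ℕ.+ p
      5+6[s+1]≡6+p = cong (6 ℕ.+_) (sym p≡)

      lemma : ∀ x y → - (x - y) ≡ y - x
      lemma = solve-∀

    -- Splitting by parity links [p/3] to [p/6]: the former is 2[p/6] for p ≡ 1 and 2[p/6] + 1 for p
    -- ≡ 5 modulo 6. This is the first case.
    sumTo-even : ∀ s → sumTo (s ℕ.* 2) ≈ g 2 * sumTo s + sumOdd s
    sumTo-even s = begin
      sumTo (s ℕ.* 2)
        ≡⟨ ∑<-even-odd s (g ∘ suc) ⟩
      sumOdd s + ∑< s (λ i → g (suc i ℕ.* 2))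
        ≈⟨ +-congˡ (sumOdd s) (∑<-multiples s 2 suc) ⟩
      sumOdd s + g 2 * sumTo s
        ≡⟨ ℤ.+-comm (sumOdd s) _ ⟩
      g 2 * sumTo s + sumOdd s ∎

    sumTo-odd : ∀ s → sumTo (suc (s ℕ.* 2)) ≈ g 2 * sumTo s + sumOdd (suc s)
    sumTo-odd s = begin
      sumTo (suc (s ℕ.* 2))
        ≡⟨ ∑<-last (s ℕ.* 2) (g ∘ suc) ⟩
      sumTo (s ℕ.* 2) + x
        ≈⟨ +-cong (sumTo-even s) (≈-refl {x}) ⟩
      g 2 * sumTo s + sumOdd s + x
        ≡⟨ ℤ.+-assoc (g 2 * sumTo s) (sumOdd s) x ⟩
      g 2 * sumTo s + (sumOdd s + x)
        ≡⟨ cong (_+_ (g 2 * sumTo s)) (∑<-last s (λ i → g (suc (i ℕ.* 2)))) ⟨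
      g 2 * sumTo s + sumOdd (suc s) ∎
      where x = g (suc (s ℕ.* 2))

    module _ (1+n<p : suc n ℕ.< p) (p>2 : 2 ℕ.< p) where

      -- The sum over all x < p vanishes by `powers≈0`, and reflection makes its two halves equal.
      sumTo-half : ∀ h → p ≡ suc (h ℕ.* 2) → sumTo h ≈ 0ℤ
      sumTo-half h p≡ = *-cancelˡ 2 (ℕ.>⇒∤ p>2) (begin
        + 2 * sumTo h
          ≡⟨ lemma (sumTo h) ⟩
        0ℤ + (sumTo h + sumTo h)
          ≈⟨ +-congˡ 0ℤ (+-congˡ (sumTo h) (∑<-reverse h (λ i j eq → g-reflect (suc i) (suc (h ℕ.+ j))
               (trans (ring i j h) (trans (cong (λ u → suc (u ℕ.+ h)) eq) (trans (ring′ h) (sym p≡))))))) ⟩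
        0ℤ + (sumTo h + ∑< h (λ i → g (suc (h ℕ.+ i))))
          ≡⟨ cong₂ _+_ g0≡0 (∑<-++ h h (g ∘ suc)) ⟨
        powers (suc (h ℕ.+ h)) n
          ≡⟨ cong (λ u → powers u n) (trans p≡ (sym (ring′ h))) ⟨
        powers p n
          ≈⟨ powers≈0 n 1+n<p ⟩
        0ℤ ∎)
        where
        ring : ∀ i j h → suc i ℕ.+ suc (h ℕ.+ j) ≡ suc (suc (i ℕ.+ j) ℕ.+ h)
        ring = ℕ-solve-∀
        ring′ : ∀ h → suc (h ℕ.+ h) ≡ suc (h ℕ.* 2)
        ring′ = ℕ-solve-∀
        lemma : ∀ x → + 2 * x ≡ 0ℤ + (x + x)
        lemma = solve-∀

      -- The odd x below p/3 are the p - 2y with p/3 < y < p/2.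
      sumOdd-reflect : ∀ t c → p ≡ suc ((t ℕ.+ c) ℕ.* 2) → sumOdd c ≈ - (g 2 * sumTo t)
      sumOdd-reflect t c p≡ = begin
        sumOdd c
          ≈⟨ ∑<-reverse c (λ i j eq → g-reflect (suc (i ℕ.* 2)) (suc (t ℕ.+ j) ℕ.* 2)
               (trans (ring i j t) (trans (cong (λ u → suc ((t ℕ.+ u) ℕ.* 2)) eq) (sym p≡)))) ⟩
        ∑< c (λ j → g (suc (t ℕ.+ j) ℕ.* 2))
          ≈⟨ ∑<-multiples c 2 (λ j → suc (t ℕ.+ j)) ⟩
        g 2 * rest
          ≈⟨ ≈-scale (g 2) (lemma (g 2) (sumTo t) rest)
               (≈-trans (≈-reflexive (sym (∑<-++ t c (g ∘ suc)))) (sumTo-half (t ℕ.+ c) p≡)) ⟩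
        - (g 2 * sumTo t) ∎
        where
        rest = ∑< c (λ j → g (suc (t ℕ.+ j)))
        ring : ∀ i j t → suc (i ℕ.* 2) ℕ.+ suc (t ℕ.+ j) ℕ.* 2 ≡ suc ((t ℕ.+ suc (i ℕ.+ j)) ℕ.* 2)
        ring = ℕ-solve-∀
        lemma : ∀ x y z → x * z - - (x * y) ≡ x * ((y + z) - 0ℤ)
        lemma = solve-∀

      module _ (p>3 : 3 ℕ.< p) (k : ℕ) (k+n≡p-1 : k ℕ.+ n ≡ ℕ.pred p) where

        -- Since k + n = p - 1, Fermat makes x^n an inverse of x^k.
        ^k*g≈1 : ∀ x → ¬ p ℕ.∣ x → (+ x) ^ k * g x ≈ 1ℤ
        ^k*g≈1 x p∤x = begin
          (+ x) ^ k * (+ x) ^ n  ≡⟨ ℤ.^-distribˡ-+-* (+ x) k n ⟨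
          (+ x) ^ (k ℕ.+ n)      ≡⟨ cong ((+ x) ^_) k+n≡p-1 ⟩
          (+ x) ^ ℕ.pred p       ≈⟨ fermat-little x p∤x ⟩
          1ℤ                     ∎

        2^k*g2≈1 : (+ 2) ^ k * g 2 ≈ 1ℤ
        2^k*g2≈1 = ^k*g≈1 2 (ℕ.>⇒∤ p>2)

        3^k*g3≈1 : (+ 3) ^ k * g 3 ≈ 1ℤ
        3^k*g3≈1 = ^k*g≈1 3 (ℕ.>⇒∤ p>3)

        module _ (s t c : ℕ) (p≡ : p ≡ suc ((t ℕ.+ c) ℕ.* 2))
                 (split : sumTo t ≈ g 2 * sumTo s + sumOdd c) where

          -- Eliminating the odd sum from `split` gives T(t) ≡ 2^n (T(s) - T(t)); multiplying by
          -- 2^k, the inverse of 2^n, gives the claim.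
          sumTo-sixth : sumTo t * ((+ 2) ^ k + 1ℤ) ≈ sumTo s
          sumTo-sixth = begin
            sumTo t * (K + 1ℤ)
              ≡⟨ lemma₁ (sumTo t) K ⟩
            K * sumTo t + 1ℤ * sumTo t
              ≈⟨ +-cong (*-congˡ K (≈-trans split (+-congˡ (g 2 * sumTo s) (sumOdd-reflect t c p≡))))
                        (*-congʳ (sumTo t) (≈-sym 2^k*g2≈1)) ⟩
            K * (g 2 * sumTo s + - (g 2 * sumTo t)) + K * g 2 * sumTo t
              ≡⟨ lemma₂ K (g 2) (sumTo s) (sumTo t) ⟩
            K * g 2 * sumTo s
              ≈⟨ *-congʳ (sumTo s) 2^k*g2≈1 ⟩
            1ℤ * sumTo s
              ≡⟨ ℤ.*-identityˡ (sumTo s) ⟩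
            sumTo s ∎
            where
            K = (+ 2) ^ k
            lemma₁ : ∀ t x → t * (x + 1ℤ) ≡ x * t + 1ℤ * t
            lemma₁ = solve-∀
            lemma₂ : ∀ x y s t → x * (y * s + - (y * t)) + x * y * t ≡ x * y * s
            lemma₂ = solve-∀

          -- Here l is 2^{k-1}. Eliminating the odd sum turns u into 2 · 6^n (T(s) + T(t)), and 6^k
          -- cancels 6^n. With `sumTo-sixth`, T(s) + T(t) becomes (2^k + 2) T(t) = 2(1 + l) T(t).
          sumTo-third : ∀ {u l} → (+ 2) ^ k ≡ + 2 * l → u ≈ + 2 * (g 6 * sumTo s - g 3 * sumOdd c) →
                        (+ 6) ^ k * u ≈ sumTo t * (+ 4 * (1ℤ + l))
          sumTo-third {u} {l} 2^k≡2*l u≈ = begin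
            (+ 6) ^ k * u
              ≈⟨ *-cong (≈-reflexive (^-distribʳ-* (+ 2) (+ 3) k))
                        (≈-trans u≈ (*-congˡ (+ 2) (‿-cong (≈-reflexive (cong (_* sumTo s) (g-* 2 3)))
                          (*-congˡ (g 3) (sumOdd-reflect t c p≡))))) ⟩
            (K * K₃) * (+ 2 * (g 2 * g 3 * sumTo s - g 3 * - (g 2 * sumTo t)))
              ≡⟨ lemma₁ K K₃ (g 2) (g 3) (sumTo s) (sumTo t) ⟩
            (K * g 2) * (K₃ * g 3) * (+ 2 * (sumTo s + sumTo t))
              ≈⟨ *-congʳ _ (*-cong 2^k*g2≈1 3^k*g3≈1) ⟩
            1ℤ * (+ 2 * (sumTo s + sumTo t))
              ≈⟨ *-congˡ 1ℤ (*-congˡ (+ 2) (+-cong (≈-sym sumTo-sixth) (≈-refl {sumTo t}))) ⟩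
            1ℤ * (+ 2 * (sumTo t * (K + 1ℤ) + sumTo t))
              ≡⟨ cong (λ x → 1ℤ * (+ 2 * (sumTo t * (x + 1ℤ) + sumTo t))) 2^k≡2*l ⟩
            1ℤ * (+ 2 * (sumTo t * (+ 2 * l + 1ℤ) + sumTo t))
              ≡⟨ lemma₂ (sumTo t) l ⟩
            sumTo t * (+ 4 * (1ℤ + l)) ∎
            where
            K  = (+ 2) ^ k
            K₃ = (+ 3) ^ k
            lemma₁ : ∀ k k₃ g g₃ s t → (k * k₃) * (+ 2 * (g * g₃ * s - g₃ * - (g * t))) ≡
                                       (k * g) * (k₃ * g₃) * (+ 2 * (s + t))
            lemma₁ = solve-∀
            lemma₂ : ∀ t l → 1ℤ * (+ 2 * (t * (+ 2 * l + 1ℤ) + t)) ≡ t * (+ 4 * (1ℤ + l))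
            lemma₂ = solve-∀

  -- Reduction of rationals modulo p

  module Reduction (p : ℕ) (p-prime : Prime p) where

    open Congruence p
    open PrimeModulus p p-prime
    open ≈-Reasoning

    infix 4 _reducesTo_

    -- The reduction map from the rationals integral at p to the integers modulo p, with its values
    -- represented by integers.
    record _reducesTo_ (q : ℚ) (z : ℤ) : Set where
      constructor reduces
      field
        p∤↧ : ¬ p ℕ.∣ ↧ₙ q
        ↥≈  : ↥ q ≈ z * ↧ q

    private
      variable
        q r : ℚ
        y z : ℤ

    -- Passing to lowest terms divides by e = gcd(|i|, d). As a divisor of d, e is prime to p and
    -- can be cancelled.
    reducesTo-/ : ∀ i d .{{_ : ℕ.NonZero d}} → ¬ p ℕ.∣ d → i ≈ z * + d → (i ℚ./ d) reducesTo z
    reducesTo-/ {z} i d p∤d i≈z*d = reduces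
      (λ p∣↧ → p∤d (subst (p ℕ.∣_) ↧*e≡d (ℕ.∣m⇒∣m*n e p∣↧)))
      (*-cancelˡ e (λ p∣e → p∤d (subst (p ℕ.∣_) ↧*e≡d (ℕ.∣n⇒∣m*n (↧ₙ x) p∣e))) (begin
        + e * ↥ x          ≡⟨ ℤ.*-comm (+ e) (↥ x) ⟩
        ↥ x * + e          ≡⟨ ℚ.↥-/ i d ⟩
        i                  ≈⟨ i≈z*d ⟩
        z * + d            ≡⟨ cong (z *_) (ℚ.↧-/ i d) ⟨
        z * (↧ x * + e)    ≡⟨ lemma z (↧ x) (+ e) ⟩
        + e * (z * ↧ x)    ∎))
      where
      x = i ℚ./ d
      e = ℕ.gcd ∣ i ∣ d
      ↧*e≡d : ↧ₙ x ℕ.* e ≡ d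
      ↧*e≡d = ℤ.+-injective (trans (ℤ.pos-* (↧ₙ x) e) (ℚ.↧-/ i d))
      lemma : ∀ x y z → x * (y * z) ≡ z * (x * y)
      lemma = solve-∀

    p∤* : ∀ {m n} → ¬ p ℕ.∣ m → ¬ p ℕ.∣ n → ¬ p ℕ.∣ m ℕ.* n
    p∤* {m} {n} p∤m p∤n p∣mn = [ p∤m , p∤n ]′ (euclidsLemma m n p-prime p∣mn)

    reducesTo-+ : q reducesTo y → r reducesTo z → (q ℚ.+ r) reducesTo (y + z)
    reducesTo-+ {q@record{}} {y} {r@record{}} {z} (reduces p∤q q≈) (reduces p∤r r≈) =
      reducesTo-/ (↥ q * ↧ r + ↥ r * ↧ q) (↧ₙ q ℕ.* ↧ₙ r) (p∤* p∤q p∤r) (begin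
        ↥ q * ↧ r + ↥ r * ↧ q              ≈⟨ +-cong (*-congʳ (↧ r) q≈) (*-congʳ (↧ q) r≈) ⟩
        y * ↧ q * ↧ r + z * ↧ r * ↧ q      ≡⟨ lemma y z (↧ q) (↧ r) ⟩
        (y + z) * (↧ q * ↧ r)              ≡⟨ cong ((y + z) *_) (ℤ.pos-* (↧ₙ q) (↧ₙ r)) ⟨
        (y + z) * + (↧ₙ q ℕ.* ↧ₙ r)        ∎)
      where
      lemma : ∀ y z s t → y * s * t + z * t * s ≡ (y + z) * (s * t)
      lemma = solve-∀

    reducesTo-* : q reducesTo y → r reducesTo z → (q ℚ.* r) reducesTo (y * z)
    reducesTo-* {q@record{}} {y} {r@record{}} {z} (reduces p∤q q≈) (reduces p∤r r≈) =
      reducesTo-/ (↥ q * ↥ r) (↧ₙ q ℕ.* ↧ₙ r) (p∤* p∤q p∤r) (begin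
        ↥ q * ↥ r                          ≈⟨ *-cong q≈ r≈ ⟩
        y * ↧ q * (z * ↧ r)                ≡⟨ lemma y z (↧ q) (↧ r) ⟩
        y * z * (↧ q * ↧ r)                ≡⟨ cong (y * z *_) (ℤ.pos-* (↧ₙ q) (↧ₙ r)) ⟨
        y * z * + (↧ₙ q ℕ.* ↧ₙ r)          ∎)
      where
      lemma : ∀ y z s t → y * s * (z * t) ≡ y * z * (s * t)
      lemma = solve-∀

    reducesTo-neg : q reducesTo z → (ℚ.- q) reducesTo (- z)
    reducesTo-neg {q} {z} (reduces p∤q q≈) = reduces
      (λ p∣↧ → p∤q (subst (p ℕ.∣_) (ℤ.+-injective (ℚ.↧-neg q)) p∣↧))
      (begin
        ↥ (ℚ.- q)         ≡⟨ ℚ.↥-neg q ⟩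
        - ↥ q             ≈⟨ ≈-scale -1ℤ (lemma₁ (↥ q) (z * ↧ q)) q≈ ⟩
        - (z * ↧ q)       ≡⟨ ℤ.neg-distribˡ-* z (↧ q) ⟩
        - z * ↧ q         ≡⟨ cong (- z *_) (ℚ.↧-neg q) ⟨
        - z * ↧ (ℚ.- q)   ∎)
      where
      lemma₁ : ∀ x y → - x - - y ≡ -1ℤ * (x - y)
      lemma₁ = solve-∀

    p∤1 : ¬ p ℕ.∣ 1
    p∤1 = ℕ.>⇒∤ (ℕ.nonTrivial⇒n>1 p {{prime⇒nonTrivial p-prime}})

    reducesTo-fromℤ : ∀ z → fromℤ z reducesTo z
    reducesTo-fromℤ z = reducesTo-/ z 1 p∤1 (≈-reflexive (sym (ℤ.*-identityʳ z)))

    reducesTo-∑ : ∀ N {f : ℕ → ℚ} {h : ℕ → ℤ} → (∀ i → i ℕ.< N → f i reducesTo h i) →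
                  foldr ℚ._+_ 0ℚ (applyUpTo f N) reducesTo ∑< N h
    reducesTo-∑ zero    f→h = reducesTo-fromℤ 0ℤ
    reducesTo-∑ (suc N) f→h =
      reducesTo-+ (f→h 0 ℕ.z<s) (reducesTo-∑ N (λ i i<N → f→h (suc i) (ℕ.s<s i<N)))

    p∤⇒coprime : ∀ {m} → ¬ p ℕ.∣ m → Coprime m p
    p∤⇒coprime p∤m (d∣m , d∣p) with prime⇒irreducible p-prime d∣p
    ... | inj₁ d≡1  = d≡1
    ... | inj₂ refl = contradiction d∣m p∤m

    coprime⇒p∤ : ∀ {m} → Coprime m p → ¬ p ℕ.∣ m
    coprime⇒p∤ c p∣m = ℕ.nonTrivial⇒≢1 {{prime⇒nonTrivial p-prime}} (c (p∣m , ℕ.∣-refl))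

    -- The difference reduces to `y - z`, so modulo p its numerator is `y - z` times its
    -- denominator.
    reducesTo⇒≡[mod] : q reducesTo y → r reducesTo z → y ≈ z → q ≡ r [mod p ]
    reducesTo⇒≡[mod] {q} {y} {r} {z} q→y r→z y≈z =
        p∤⇒coprime (_reducesTo_.p∤↧ q→y)
      , p∤⇒coprime (_reducesTo_.p∤↧ r→z)
      , subst (+ p ℤ.∣_) (ℤ.+-identityʳ (↥ (q ℚ.- r))) (p∣x-y (begin
          ↥ (q ℚ.- r)               ≈⟨ _reducesTo_.↥≈ (reducesTo-+ q→y (reducesTo-neg r→z)) ⟩
          (y - z) * ↧ (q ℚ.- r)     ≈⟨ ≈-scale (↧ (q ℚ.- r)) (lemma y z (↧ (q ℚ.- r))) y≈z ⟩
          0ℤ                        ∎))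
      where
      lemma : ∀ y z d → (y - z) * d - 0ℤ ≡ d * (y - z)
      lemma = solve-∀

  -- Sums over multiples and the residue of p modulo 6.

  pos-^ : ∀ m n → + (m ℕ.^ n) ≡ (+ m) ^ n
  pos-^ m zero    = refl
  pos-^ m (suc n) = trans (ℤ.pos-* m (m ℕ.^ n)) (cong (+ m *_) (pos-^ m n))

  -- Index j stands for the argument j + 1. Each block of d arguments contains one multiple of d,
  -- its last; the e arguments left over contain none.
  ∑<-divisible : ∀ {p} → let open Congruence p in
    ∀ d s e (f : ℕ → ℤ) → e ℕ.< d →
    ∑< (s ℕ.* d ℕ.+ e) (λ j → if does (d ℕ.∣? suc j) then f (suc j) else 0ℤ) ≈
    ∑< s (λ i → f (suc i ℕ.* d))
  ∑<-divisible {p} d@(suc d′) s e f e<d = go s f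
    where
    open Congruence p
    open ≈-Reasoning

    term : (ℕ → ℤ) → ℕ → ℤ
    term f j = if does (d ℕ.∣? suc j) then f (suc j) else 0ℤ

    below-d : ∀ m f → m ℕ.< d → ∑< m (term f) ≈ 0ℤ
    below-d m f m<d = ∑<-zero m λ i i<m → ≈-reflexive
      (cong (λ b → if b then f (suc i) else 0ℤ) (dec-false (d ℕ.∣? suc i) (ℕ.>⇒∤ (ℕ.≤-<-trans i<m m<d))))

    shift : ∀ f j → term f (d ℕ.+ j) ≡ term (f ∘ (d ℕ.+_)) j
    shift f j = cong₂ (λ b x → if b then x else 0ℤ)
      (does-⇔ (mk⇔ (λ d∣ → ℕ.∣m+n∣m⇒∣n (subst (d ℕ.∣_) (sym (ℕ.+-suc d j)) d∣) ℕ.∣-refl)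
                   (λ d∣ → subst (d ℕ.∣_) (ℕ.+-suc d j) (ℕ.∣m∣n⇒∣m+n ℕ.∣-refl d∣)))
              (d ℕ.∣? suc (d ℕ.+ j)) (d ℕ.∣? suc j))
      (cong f (sym (ℕ.+-suc d j)))

    go : ∀ s f → ∑< (s ℕ.* d ℕ.+ e) (term f) ≈ ∑< s (λ i → f (suc i ℕ.* d))
    go zero    f = below-d e f e<d
    go (suc s) f = begin
      ∑< (d ℕ.+ s ℕ.* d ℕ.+ e) (term f)
        ≡⟨ cong (λ u → ∑< u (term f)) (ℕ.+-assoc d (s ℕ.* d) e) ⟩
      ∑< (d ℕ.+ (s ℕ.* d ℕ.+ e)) (term f)
        ≡⟨ ∑<-++ d (s ℕ.* d ℕ.+ e) (term f) ⟩
      ∑< d (term f) + ∑< (s ℕ.* d ℕ.+ e) (λ j → term f (d ℕ.+ j))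
        ≈⟨ +-cong first (∑<-cong (s ℕ.* d ℕ.+ e) (λ j _ → ≈-reflexive (shift f j))) ⟩
      f (d ℕ.+ 0) + ∑< (s ℕ.* d ℕ.+ e) (term (f ∘ (d ℕ.+_)))
        ≈⟨ +-congˡ (f (d ℕ.+ 0)) (go s (f ∘ (d ℕ.+_))) ⟩
      ∑< (suc s) (λ i → f (suc i ℕ.* d)) ∎
      where
      first : ∑< d (term f) ≈ f (d ℕ.+ 0)
      first = begin
        ∑< d (term f)
          ≡⟨ ∑<-last d′ (term f) ⟩
        ∑< d′ (term f) + term f d′
          ≈⟨ +-cong (below-d d′ f ℕ.≤-refl) (≈-reflexive
               (cong (λ b → if b then f d else 0ℤ) (dec-true (d ℕ.∣? d) ℕ.∣-refl))) ⟩
        0ℤ + f d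
          ≡⟨ ℤ.+-identityˡ (f d) ⟩
        f d
          ≡⟨ cong f (ℕ.+-identityʳ d) ⟨
        f (d ℕ.+ 0) ∎

  [r+q*d]/d≡q : ∀ r q d .{{_ : ℕ.NonZero d}} → r ℕ.< d → (r ℕ.+ q ℕ.* d) ℕ./ d ≡ q
  [r+q*d]/d≡q r q d r<d = trans (ℕ.+-distrib-/-∣ʳ r (ℕ.n∣m*n q))
    (cong₂ ℕ._+_ (ℕ.m<n⇒m/n≡0 r<d) (ℕ.m*n/n≡m q d))

  prime∤ : ∀ {p d} → Prime p → 1 ℕ.< d → d ℕ.< p → ¬ d ℕ.∣ p
  prime∤ p-prime 1<d d<p d∣p with prime⇒irreducible p-prime d∣p
  ... | inj₁ refl = ℕ.<-irrefl refl 1<d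
  ... | inj₂ refl = ℕ.<-irrefl refl d<p

  prime-mod6 : ∀ {p} → Prime p → 3 ℕ.< p → p ≡ 1 ℕ.+ p ℕ./ 6 ℕ.* 6 ⊎ p ≡ 5 ℕ.+ p ℕ./ 6 ℕ.* 6
  prime-mod6 {p} p-prime 3<p = go (p ℕ.% 6) (ℕ.m%n<n p 6) (ℕ.m≡m%n+[m/n]*n p 6)
    where
    s = p ℕ./ 6

    excluded : ∀ {d r} {A : Set} → 1 ℕ.< d → d ℕ.< p → d ℕ.∣ r → d ℕ.∣ 6 → p ≡ r ℕ.+ s ℕ.* 6 → A
    excluded {d} 1<d d<p d∣r d∣6 p≡ = contradiction
      (subst (d ℕ.∣_) (sym p≡) (ℕ.∣m∣n⇒∣m+n d∣r (ℕ.∣n⇒∣m*n s d∣6)))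
      (prime∤ p-prime 1<d d<p)

    1<2 : 1 ℕ.< 2
    1<2 = ℕ.s<s ℕ.z<s

    2<p : 2 ℕ.< p
    2<p = ℕ.<-trans ℕ.≤-refl 3<p

    go : ∀ r → r ℕ.< 6 → p ≡ r ℕ.+ s ℕ.* 6 → p ≡ 1 ℕ.+ s ℕ.* 6 ⊎ p ≡ 5 ℕ.+ s ℕ.* 6
    go 0 _ p≡ = excluded 1<2 2<p (ℕ.divides 0 refl) (ℕ.divides 3 refl) p≡
    go 1 _ p≡ = inj₁ p≡
    go 2 _ p≡ = excluded 1<2 2<p (ℕ.divides 1 refl) (ℕ.divides 3 refl) p≡
    go 3 _ p≡ = excluded (ℕ.s<s ℕ.z<s) 3<p (ℕ.divides 1 refl) (ℕ.divides 2 refl) p≡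
    go 4 _ p≡ = excluded 1<2 2<p (ℕ.divides 2 refl) (ℕ.divides 3 refl) p≡
    go 5 _ p≡ = inj₂ p≡
    go (suc (suc (suc (suc (suc (suc r)))))) (ℕ.s≤s (ℕ.s≤s (ℕ.s≤s (ℕ.s≤s (ℕ.s≤s (ℕ.s≤s ())))))) p≡

  legendre₃≡1 : ∀ {p} → p ℕ.% 3 ≡ 1 → legendre₃ p ≡ 1ℤ
  legendre₃≡1 {p} eq with p ℕ.% 3
  legendre₃≡1 refl | .1 = refl

  legendre₃≡-1 : ∀ {p} → p ℕ.% 3 ≡ 2 → legendre₃ p ≡ -1ℤ
  legendre₃≡-1 {p} eq with p ℕ.% 3
  legendre₃≡-1 refl | .2 = refl

  -- Sums of negative powers modulo p.

  module NegativePowers (p k : ℕ) (p-prime : Prime p) (3<p : 3 ℕ.< p) (2≤k : 2 ℕ.≤ k) (k≤p-3 : k ℕ.≤ p ℕ.∸ 3) where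

    open Congruence p
    open PrimeModulus p p-prime
    open Reduction p p-prime
    open ≈-Reasoning

    private
      n = p ℕ.∸ 1 ℕ.∸ k

    k+3≤p : k ℕ.+ 3 ℕ.≤ p
    k+3≤p = ℕ.≤-trans (ℕ.+-monoˡ-≤ 3 k≤p-3) (ℕ.≤-reflexive (ℕ.m∸n+n≡m (ℕ.<⇒≤ 3<p)))

    k+2≤p-1 : k ℕ.+ 2 ℕ.≤ p ℕ.∸ 1
    k+2≤p-1 = ℕ.≤-trans (ℕ.≤-reflexive (cong (ℕ._∸ 1) (sym (ℕ.+-suc k 2)))) (ℕ.∸-monoˡ-≤ 1 k+3≤p)

    k+n≡p-1 : k ℕ.+ n ≡ p ℕ.∸ 1
    k+n≡p-1 = ℕ.m+[n∸m]≡n (ℕ.≤-trans (ℕ.m≤m+n k 2) k+2≤p-1)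

    0<n : 0 ℕ.< n
    0<n = ℕ.≤-trans (ℕ.s≤s ℕ.z≤n) (ℕ.+-cancelˡ-≤ k 2 n (ℕ.≤-trans k+2≤p-1 (ℕ.≤-reflexive (sym k+n≡p-1))))

    1+p-1≡p : suc (p ℕ.∸ 1) ≡ p
    1+p-1≡p = ℕ.suc-pred p {{prime⇒nonZero p-prime}}

    -- k > 0 keeps n below p - 1, the exponent at which the full power sum would be -1 instead of 0
    -- modulo p.
    1+n<p : suc n ℕ.< p
    1+n<p = ℕ.≤-trans (ℕ.s≤s (ℕ.≤-trans (ℕ.+-monoˡ-≤ n (ℕ.≤-trans (ℕ.s≤s ℕ.z≤n) 2≤k)) (ℕ.≤-reflexive k+n≡p-1)))
                      (ℕ.≤-reflexive 1+p-1≡p)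

    2<p : 2 ℕ.< p
    2<p = ℕ.<-trans ℕ.≤-refl 3<p

    module Relations (2∣n : 2 ℕ.∣ n) where

      open EvenPowers p p-prime n 2∣n 0<n public

      p∤2 : ¬ p ℕ.∣ 2
      p∤2 = ℕ.>⇒∤ 2<p

      p∤3 : ¬ p ℕ.∣ 3
      p∤3 = ℕ.>⇒∤ 3<p

      module _ (d : ℕ) (p∤d : ¬ p ℕ.∣ d) where

        inverse-power : (+ d) ^ k * g d ≈ 1ℤ
        inverse-power = ^k*g≈1 1+n<p 2<p 3<p k k+n≡p-1 d p∤d

      reducesTo-1/^ : ∀ i → suc i ℕ.< p → (1/ suc i ^ k) reducesTo g (suc i)
      reducesTo-1/^ i i+1<p = reducesTo-/ 1ℤ (suc i ℕ.^ k) {{ℕ.m^n≢0 (suc i) k}} p∤x^k (begin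
        1ℤ                        ≈⟨ inverse-power (suc i) p∤x ⟨
        (+ suc i) ^ k * g (suc i) ≡⟨ ℤ.*-comm _ (g (suc i)) ⟩
        g (suc i) * (+ suc i) ^ k ≡⟨ cong (g (suc i) *_) (pos-^ (suc i) k) ⟨
        g (suc i) * + (suc i ℕ.^ k) ∎)
        where
        p∤x : ¬ p ℕ.∣ suc i
        p∤x = ℕ.>⇒∤ i+1<p

        p∤^ : ∀ j → ¬ p ℕ.∣ suc i ℕ.^ j
        p∤^ zero    = p∤1
        p∤^ (suc j) = p∤* p∤x (p∤^ j)

        p∤x^k = p∤^ k

      reducesTo-powerSum : ∀ N → N ℕ.< p → powerSum N k reducesTo sumTo N
      reducesTo-powerSum N N<p = reducesTo-∑ N λ i i<N → reducesTo-1/^ i (ℕ.≤-<-trans i<N N<p)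

      termAP : ℕ → ℕ → ℤ
      termAP d i = if does (+ d ℤ.∣? (+ suc i - + p)) then g (suc i) else 0ℤ

      reducesTo-powerSumAP : ∀ d → powerSumAP d p (p ℕ.∸ 1) k reducesTo ∑< (p ℕ.∸ 1) (termAP d)
      reducesTo-powerSumAP d = reducesTo-∑ (p ℕ.∸ 1) λ i i<p-1 →
        reducesTo-if (does (+ d ℤ.∣? (+ suc i - + p)))
          (reducesTo-1/^ i (ℕ.≤-trans (ℕ.s≤s i<p-1) (ℕ.≤-reflexive 1+p-1≡p)))
        where
        reducesTo-if : ∀ b {q z} → q reducesTo z → (if b then q else 0ℚ) reducesTo (if b then z else 0ℤ)
        reducesTo-if false q→z = reducesTo-fromℤ 0ℤ
        reducesTo-if true  q→z = q→z

      -- x ↦ p - x turns x ≡ p (mod d) into d ∣ x.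
      termAP-reflect : ∀ d i j → suc (i ℕ.+ j) ≡ p ℕ.∸ 1 →
                       termAP d i ≈ (if does (d ℕ.∣? suc j) then g (suc j) else 0ℤ)
      termAP-reflect d i j eq = begin
        termAP d i
          ≡⟨ cong (λ b → if b then g (suc i) else 0ℤ)
               (does-⇔ (mk⇔ to from) (+ d ℤ.∣? (+ suc i - + p)) (d ℕ.∣? suc j)) ⟩
        (if does (d ℕ.∣? suc j) then g (suc i) else 0ℤ)
          ≈⟨ if-cong (does (d ℕ.∣? suc j)) (g-reflect (suc i) (suc j) x+y≡p) ⟩
        (if does (d ℕ.∣? suc j) then g (suc j) else 0ℤ) ∎
        where
        x+y≡p : suc i ℕ.+ suc j ≡ p
        x+y≡p = trans (cong suc (trans (ℕ.+-suc i j) eq)) 1+p-1≡p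

        lemma : ∀ x y → x - (x + y) ≡ - y
        lemma = solve-∀

        x-p≡-y : + suc i - + p ≡ - + suc j
        x-p≡-y = trans (cong (λ u → + suc i - + u) (sym x+y≡p)) (lemma (+ suc i) (+ suc j))

        to : + d ℤ.∣ + suc i - + p → d ℕ.∣ suc j
        to d∣ = ℤ.∣⇒∣ᵤ (subst (+ d ℤ.∣_) x-p≡-y d∣)

        from : d ℕ.∣ suc j → + d ℤ.∣ + suc i - + p
        from d∣ = subst (+ d ℤ.∣_) (sym x-p≡-y) (ℤ.∣m⇒∣-m (ℤ.∣ᵤ⇒∣ {+ d} {+ suc j} d∣))

        if-cong : ∀ b {x y} → x ≈ y → (if b then x else 0ℤ) ≈ (if b then y else 0ℤ)
        if-cong false x≈y = ≈-refl
        if-cong true  x≈y = x≈y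

      sumAP : ∀ d .{{_ : ℕ.NonZero d}} → ¬ d ℕ.∣ p → ∑< (p ℕ.∸ 1) (termAP d) ≈ g d * sumTo (p ℕ./ d)
      sumAP d d∤p = begin
        ∑< (p ℕ.∸ 1) (termAP d)
          ≈⟨ ∑<-reverse (p ℕ.∸ 1) (termAP-reflect d) ⟩
        ∑< (p ℕ.∸ 1) divisible
          ≡⟨ cong (λ u → ∑< u divisible) p-1≡ ⟩
        ∑< (s ℕ.* d ℕ.+ ℕ.pred r) divisible
          ≈⟨ ∑<-divisible d s (ℕ.pred r) g (ℕ.≤-<-trans ℕ.pred[n]≤n (ℕ.m%n<n p d)) ⟩
        ∑< s (λ i → g (suc i ℕ.* d))
          ≈⟨ ∑<-multiples s d suc ⟩
        g d * sumTo s ∎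
        where
        s = p ℕ./ d
        r = p ℕ.% d
        divisible : ℕ → ℤ
        divisible j = if does (d ℕ.∣? suc j) then g (suc j) else 0ℤ

        r≢0 : ℕ.NonZero r
        r≢0 = ℕ.≢-nonZero λ r≡0 → d∤p (ℕ.m%n≡0⇒n∣m p d r≡0)

        -- As d does not divide p, the remainder r is positive, so p - 1 has the same quotient by d
        -- as p and the remainder r - 1.
        p-1≡ : p ℕ.∸ 1 ≡ s ℕ.* d ℕ.+ ℕ.pred r
        p-1≡ = trans (cong ℕ.pred (trans (ℕ.m≡m%n+[m/n]*n p d) (cong (ℕ._+ s ℕ.* d) (sym (ℕ.suc-pred r {{r≢0}})))))
                     (ℕ.+-comm (ℕ.pred r) (s ℕ.* d))

      reducesTo-resp-≈ : ∀ {q y z} → y ≈ z → q reducesTo y → q reducesTo z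
      reducesTo-resp-≈ {q} y≈z (reduces p∤↧ ↥≈) = reduces p∤↧ (≈-trans ↥≈ (*-congʳ (↧ q) y≈z))

      -- The factor d^k cancels the d^n that `sumAP` takes out of the multiples of d.
      scaledAP : ∀ d .{{_ : ℕ.NonZero d}} → ¬ d ℕ.∣ p → ¬ p ℕ.∣ d →
                 (fromℤ (+ (d ℕ.^ k)) ℚ.* powerSumAP d p (p ℕ.∸ 1) k) reducesTo sumTo (p ℕ./ d)
      scaledAP d d∤p p∤d = reducesTo-resp-≈ (begin
        + (d ℕ.^ k) * ∑< (p ℕ.∸ 1) (termAP d)
          ≈⟨ *-cong (≈-reflexive (pos-^ d k)) (sumAP d d∤p) ⟩
        (+ d) ^ k * (g d * sumTo (p ℕ./ d))
          ≡⟨ ℤ.*-assoc ((+ d) ^ k) (g d) _ ⟨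
        (+ d) ^ k * g d * sumTo (p ℕ./ d)
          ≈⟨ *-congʳ _ (inverse-power d p∤d) ⟩
        1ℤ * sumTo (p ℕ./ d)
          ≡⟨ ℤ.*-identityˡ _ ⟩
        sumTo (p ℕ./ d) ∎) (reducesTo-* (reducesTo-fromℤ (+ (d ℕ.^ k))) (reducesTo-powerSumAP d))

      -- As d is invertible modulo p, a congruence cleared of the denominator suffices.
      reducesTo-quotient : ∀ i d .{{_ : ℕ.NonZero d}} x y {z} → ¬ p ℕ.∣ d → i * (x * y) ≈ z * + d →
                           ((i ℚ./ d) ℚ.* fromℤ x ℚ.* fromℤ y) reducesTo z
      reducesTo-quotient i d x y {z} p∤d eq = reducesTo-resp-≈
        (*-cancelˡ d p∤d (begin
          + d * (i * d⁻¹ * x * y)      ≡⟨ lemma₁ (+ d) i d⁻¹ x y ⟩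
          (+ d * d⁻¹) * (i * (x * y))  ≈⟨ *-cong d*d⁻¹≈1 eq ⟩
          1ℤ * (z * + d)               ≡⟨ lemma₂ z (+ d) ⟩
          + d * z                      ∎))
        (reducesTo-* (reducesTo-* (reducesTo-/ {i * d⁻¹} i d p∤d i≈) (reducesTo-fromℤ x)) (reducesTo-fromℤ y))
        where
        -- An inverse of d modulo p, by Fermat.
        d⁻¹ = (+ d) ^ (p ℕ.∸ 2)

        lemma₁ : ∀ d i e x y → d * (i * e * x * y) ≡ (d * e) * (i * (x * y))
        lemma₁ = solve-∀

        lemma₂ : ∀ z d → 1ℤ * (z * d) ≡ d * z
        lemma₂ = solve-∀

        lemma₃ : ∀ i e d → i - i * e * d ≡ - i * (d * e - 1ℤ)
        lemma₃ = solve-∀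

        d*d⁻¹≈1 : + d * d⁻¹ ≈ 1ℤ
        d*d⁻¹≈1 = ≈-trans (≈-reflexive (cong ((+ d) ^_) (sym (ℕ.+-∸-assoc 1 (ℕ.<⇒≤ 2<p))))) (fermat-little d p∤d)

        i≈ : i ≈ i * d⁻¹ * + d
        i≈ = ≈-scale (- i) (lemma₃ i d⁻¹ (+ d)) d*d⁻¹≈1

      -- `ε` stands for (p/3) and `c` for the number of odd x ≤ p/3, so that both residues of p
      -- modulo 6 are treated at once.
      module _ (ε : ℤ) (c : ℕ) (p≡ : p ≡ suc ((p ℕ./ 3 ℕ.+ c) ℕ.* 2))
               (split : sumTo (p ℕ./ 3) ≈ g 2 * sumTo (p ℕ./ 6) + sumOdd c)
               (εU≈ : ε * U n ≈ + 2 * (g 6 * sumTo (p ℕ./ 6) - g 3 * sumOdd c)) where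

        private
          s = p ℕ./ 6
          t = p ℕ./ 3
          B = 4 ℕ.* (1 ℕ.+ 2 ℕ.^ (k ℕ.∸ 1))

        sixth : sumTo t * ((+ 2) ^ k + 1ℤ) ≈ sumTo s
        sixth = sumTo-sixth 1+n<p 2<p 3<p k k+n≡p-1 s t c p≡ split

        third : + (6 ℕ.^ k) * (ε * U n) ≈ sumTo t * + B
        third = begin
          + (6 ℕ.^ k) * (ε * U n)
            ≡⟨ cong (_* (ε * U n)) (pos-^ 6 k) ⟩
          (+ 6) ^ k * (ε * U n)
            ≈⟨ sumTo-third 1+n<p 2<p 3<p k k+n≡p-1 s t c p≡ split
                 -- `l` is 2^{k-1}, available because k is positive.
                 (cong ((+ 2) ^_) (sym (ℕ.suc-pred k {{ℕ.>-nonZero (ℕ.<⇒≤ 2≤k)}}))) εU≈ ⟩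
          sumTo t * (+ 4 * (1ℤ + (+ 2) ^ (k ℕ.∸ 1)))
            ≡⟨ cong (λ u → sumTo t * (+ 4 * (1ℤ + u))) (pos-^ 2 (k ℕ.∸ 1)) ⟨
          sumTo t * (+ 4 * + (1 ℕ.+ 2 ℕ.^ (k ℕ.∸ 1)))
            ≡⟨ cong (sumTo t *_) (ℤ.pos-* 4 (1 ℕ.+ 2 ℕ.^ (k ℕ.∸ 1))) ⟨
          sumTo t * + B ∎

        quotient-third : ¬ p ℕ.∣ B → ((+ (6 ℕ.^ k) ℚ./ B) ℚ.* fromℤ ε ℚ.* fromℤ (U n)) reducesTo sumTo t
        quotient-third p∤B = reducesTo-quotient (+ (6 ℕ.^ k)) B ε (U n) p∤B third

        -- Multiply `third` by 2^k + 1 and apply `sixth`.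
        quotient-sixth : ¬ p ℕ.∣ B →
          ((+ (6 ℕ.^ k ℕ.* (2 ℕ.^ k ℕ.+ 1)) ℚ./ B) ℚ.* fromℤ ε ℚ.* fromℤ (U n)) reducesTo sumTo s
        quotient-sixth p∤B = reducesTo-quotient (+ (6 ℕ.^ k ℕ.* (2 ℕ.^ k ℕ.+ 1))) B ε (U n) p∤B (begin
          + (6 ℕ.^ k ℕ.* (2 ℕ.^ k ℕ.+ 1)) * (ε * U n)
            ≡⟨ cong (_* (ε * U n)) (trans (ℤ.pos-* (6 ℕ.^ k) _)
                 (cong (λ u → + (6 ℕ.^ k) * (u + 1ℤ)) (pos-^ 2 k))) ⟩
          + (6 ℕ.^ k) * (K + 1ℤ) * (ε * U n)
            ≡⟨ lemma₁ (+ (6 ℕ.^ k)) (K + 1ℤ) (ε * U n) ⟩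
          + (6 ℕ.^ k) * (ε * U n) * (K + 1ℤ)
            ≈⟨ *-congʳ (K + 1ℤ) third ⟩
          sumTo t * + B * (K + 1ℤ)
            ≡⟨ lemma₁ (sumTo t) (+ B) (K + 1ℤ) ⟩
          sumTo t * (K + 1ℤ) * + B
            ≈⟨ *-congʳ (+ B) sixth ⟩
          sumTo s * + B ∎)
          where
          K = (+ 2) ^ k
          lemma₁ : ∀ x y z → x * y * z ≡ x * z * y
          lemma₁ = solve-∀

  -- c counts the odd x ≤ p/3, and t + c = (p-1)/2 for t = [p/3].
  thirds : ∀ {p} → Prime p → 3 ℕ.< p → let s = p ℕ./ 6; t = p ℕ./ 3 in
    ∃ λ c → p ≡ suc ((t ℕ.+ c) ℕ.* 2) ×
    (∀ (p-prime : Prime p) n (2∣n : 2 ℕ.∣ n) (0<n : 0 ℕ.< n) →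
     let open Congruence p
         open EvenPowers p p-prime n 2∣n 0<n
     in
     sumTo t ≈ g 2 * sumTo s + sumOdd c ×
     legendre₃ p * U n ≈ + 2 * (g 6 * sumTo s - g 3 * sumOdd c))
  thirds {p} p-prime 3<p with prime-mod6 p-prime 3<p
  -- Here p = 6s + 1 and t = 2s, so there are s odd x up to t.
  ... | inj₁ p≡ = s , trans p≡ (trans (ring s) (cong (λ u → suc ((u ℕ.+ s) ℕ.* 2)) (sym p/3≡))) ,
    λ p-prime n 2∣n 0<n →
      let open Congruence p
          open EvenPowers p p-prime n 2∣n 0<n
      in
      ≈-trans (≈-reflexive (cong sumTo p/3≡)) (sumTo-even s) ,
      ≈-trans (≈-reflexive (trans (cong (_* U n) legendre≡) (ℤ.*-identityˡ (U n)))) (U≈-1mod6 s p≡)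
    where
    s = p ℕ./ 6

    ring : ∀ s → 1 ℕ.+ s ℕ.* 6 ≡ suc ((s ℕ.* 2 ℕ.+ s) ℕ.* 2)
    ring = ℕ-solve-∀

    p≡1+3[2*s] : p ≡ 1 ℕ.+ s ℕ.* 2 ℕ.* 3
    p≡1+3[2*s] = trans p≡ (cong suc (sym (ℕ.*-assoc s 2 3)))

    p/3≡ : p ℕ./ 3 ≡ s ℕ.* 2
    p/3≡ = trans (cong (ℕ._/ 3) p≡1+3[2*s]) ([r+q*d]/d≡q 1 (s ℕ.* 2) 3 (ℕ.s<s ℕ.z<s))

    legendre≡ : legendre₃ p ≡ 1ℤ
    legendre≡ = legendre₃≡1 {p} (trans (cong (ℕ._% 3) p≡1+3[2*s]) (ℕ.[m+kn]%n≡m%n 1 (s ℕ.* 2) 3))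
  -- Here p = 6s + 5 and t = 2s + 1, so there are s + 1 odd x up to t.
  ... | inj₂ p≡ = suc s , trans p≡ (trans (ring s) (cong (λ u → suc ((u ℕ.+ suc s) ℕ.* 2)) (sym p/3≡))) ,
    λ p-prime n 2∣n 0<n →
      let open Congruence p
          open EvenPowers p p-prime n 2∣n 0<n
      in
      ≈-trans (≈-reflexive (cong sumTo p/3≡)) (sumTo-odd s) ,
      ≈-trans (≈-reflexive (trans (cong (_* U n) legendre≡) (ℤ.-1*i≡-i (U n)))) (-U≈-5mod6 s p≡)
    where
    s = p ℕ./ 6

    ring : ∀ s → 5 ℕ.+ s ℕ.* 6 ≡ suc ((suc (s ℕ.* 2) ℕ.+ suc s) ℕ.* 2)
    ring = ℕ-solve-∀

    p≡2+3[1+2*s] : p ≡ 2 ℕ.+ suc (s ℕ.* 2) ℕ.* 3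
    p≡2+3[1+2*s] = trans p≡ (cong (5 ℕ.+_) (sym (ℕ.*-assoc s 2 3)))

    p/3≡ : p ℕ./ 3 ≡ suc (s ℕ.* 2)
    p/3≡ = trans (cong (ℕ._/ 3) p≡2+3[1+2*s]) ([r+q*d]/d≡q 2 (suc (s ℕ.* 2)) 3 (ℕ.s<s (ℕ.s<s ℕ.z<s)))

    legendre≡ : legendre₃ p ≡ -1ℤ
    legendre≡ = legendre₃≡-1 {p} (trans (cong (ℕ._% 3) p≡2+3[1+2*s]) (ℕ.[m+kn]%n≡m%n 2 (suc (s ℕ.* 2)) 3))

open import Data.Nat.Base using (_+_; _*_; _∸_; _^_; _≤_; _<_; _/_)
open import Data.Nat.Divisibility using (_∣_)

theorem3p3 : (p k : ℕ) → Prime p → 3 < p → 2 ∣ k → 2 ≤ k → k ≤ p ∸ 3 →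
    (powerSum (p / 6) k ≡ fromℤ (+ (6 ^ k)) ℚ.* powerSumAP 6 p (p ∸ 1) k [mod p ]
    × (Coprime (4 * (1 + 2 ^ (k ∸ 1))) p →
    fromℤ (+ (6 ^ k)) ℚ.* powerSumAP 6 p (p ∸ 1) k
    ≡ (+ (6 ^ k * (2 ^ k + 1)) ℚ./ (4 * (1 + 2 ^ (k ∸ 1)))) ℚ.* fromℤ (legendre₃ p) ℚ.* fromℤ (U (p ∸ 1 ∸ k)) [mod p ]))
    × (powerSum (p / 3) k ≡ fromℤ (+ (3 ^ k)) ℚ.* powerSumAP 3 p (p ∸ 1) k [mod p ]
    × (Coprime (4 * (1 + 2 ^ (k ∸ 1))) p →
    fromℤ (+ (3 ^ k)) ℚ.* powerSumAP 3 p (p ∸ 1) k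
    ≡ (+ (6 ^ k) ℚ./ (4 * (1 + 2 ^ (k ∸ 1)))) ℚ.* fromℤ (legendre₃ p) ℚ.* fromℤ (U (p ∸ 1 ∸ k)) [mod p ]))
theorem3p3 p k p-prime 3<p 2∣k 2≤k k≤p-3 with thirds p-prime 3<p
... | c , p≡ , relations =
    -- All three members of a chain reduce to one integer, T([p/6]) in the first chain and T([p/3])
    -- in the second, so reflexivity closes each congruence.
    ( reducesTo⇒≡[mod] (reducesTo-powerSum (p / 6) (ℕ.m/n<m p 6 (ℕ.s<s ℕ.z<s))) sum₆ ≈-refl
    , λ B⊥p → reducesTo⇒≡[mod] sum₆
        (quotient-sixth (legendre₃ p) c p≡ (proj₁ relation) (proj₂ relation) (coprime⇒p∤ B⊥p)) ≈-refl)
  , ( reducesTo⇒≡[mod] (reducesTo-powerSum (p / 3) (ℕ.m/n<m p 3 (ℕ.s<s ℕ.z<s))) sum₃ ≈-refl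
    , λ B⊥p → reducesTo⇒≡[mod] sum₃
        (quotient-third (legendre₃ p) c p≡ (proj₁ relation) (proj₂ relation) (coprime⇒p∤ B⊥p)) ≈-refl)
  where
  instance
    _ = prime⇒nonZero p-prime

  open NegativePowers p k p-prime 3<p 2≤k k≤p-3
  open Congruence p
  open Reduction p p-prime

  2∣n : 2 ∣ p ∸ 1 ∸ k
  -- k + n = p - 1 = 2([p/3] + c) is even, and so is k.
  2∣n = ℕ.∣m+n∣m⇒∣n (subst (2 ∣_) (sym k+n≡p-1) (ℕ.divides (p / 3 + c) (cong (_∸ 1) p≡))) 2∣k

  open Relations 2∣n

  relation = relations p-prime (p ∸ 1 ∸ k) 2∣n 0<n

  sum₆ = scaledAP 6 (λ 6∣p → prime∤ p-prime ℕ.≤-refl 2<p (ℕ.∣-trans (ℕ.divides 3 refl) 6∣p)) (p∤* p∤2 p∤3)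
  sum₃ = scaledAP 3 (prime∤ p-prime (ℕ.s<s ℕ.z<s) 3<p) p∤3
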